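{- Let $p$ be an odd prime and let $G=\langle a,b,c \mid a^p=b^p=c^p=1,\ [a,b]=c,\ [c,a]=[c,b]=1\rangle$. Let $\Sigma=\mathrm{Cos}(G,\langle a\rangle,\langle b\rangle)$ be the graph with vertex set $\{\langle a\rangle g\mid g\in G\}\cup\{\langle b\rangle h\mid h\in G\}$ and with edges all the coset pairs $\{\langle a\rangle g,\langle b\rangle h\}$ such that $\langle a\rangle g\cap\langle b\rangle h\neq\emptyset$. Then $\Sigma$ is $3$-arc-regular, that is, $\mathrm{Aut}(\Sigma)$ is regular on the set of $3$-arcs of $\Sigma$.
   Context: All graphs are finite, simple and undirected, and $\mathrm{Aut}(\Sigma)$ is the full automorphism group of $\Sigma$. Here $[x,y]=x^{ -1}y^{ -1}xy$. A $3$-arc of a graph $\Sigma$ is a sequence $v_0,v_1,v_2,v_3$ of vertices such that $v_{i-1},v_i$ are adjacent for $1\le i\le 3$ and $v_{i-1}\neq v_{i+1}$ for $1\le i\le 2$. A group action is regular if it is transitive and all point stabilizers are trivial. -}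

module Defs where

open import Level using (Level; 0ℓ; _⊔_) renaming (suc to lsuc)
open import Algebra.Bundles using (Group; RawGroup)
import Algebra.Definitions.RawMonoid as RawMonoidDefinitions
open import Data.Integer.Base as ℤ using (ℤ; +_; -[1+_]; 0ℤ; 1ℤ)
open import Data.Integer.Divisibility.Signed as ℤ∣ using ()
import Data.Integer.Properties as ℤ
open import Data.Integer.Tactic.RingSolver using (solve-∀)
open import Data.Nat.Base as ℕ using (ℕ; zero; suc)
open import Data.Nat.Divisibility using (∣1⇒≡1)
open import Data.Nat.Primality using (Prime; ¬prime[1])
open import Data.Product.Base using (∃; ∃₂; _×_; _,_; proj₁; proj₂)
open import Data.Sum.Base using (_⊎_; inj₁; inj₂)
open import Function.Bundles using (Inverse; _⇔_; mk⇔; Equivalence)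
import Function.Construct.Composition as Composition
import Function.Construct.Identity as Identity
import Function.Construct.Symmetry as Symmetry
open import Relation.Binary.Bundles using (Setoid)
open import Relation.Binary.Core using (Rel)
open import Relation.Binary.PropositionalEquality as ≡ using (_≡_)
open import Relation.Nullary.Negation.Core using (¬_)
open import Relation.Unary using (Pred; _∩_; _≐_; Satisfiable)
open import Relation.Unary.Properties using (≐-refl; ≐-sym; ≐-trans)

private
  variable
    a c d ℓ r : Level

record Action (G : Group c ℓ) (X : Setoid a r) : Set (c ⊔ ℓ ⊔ a ⊔ r) where
  private
    module G = Group G
    module X = Setoid X
  infixr 7 _·_
  field
    _·_    : G.Carrier → X.Carrier → X.Carrier
    ·-cong : ∀ {g h x y} → g G.≈ h → x X.≈ y → (g · x) X.≈ (h · y)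
    ·-ε    : ∀ x → (G.ε · x) X.≈ x
    ·-∙    : ∀ g h x → ((g G.∙ h) · x) X.≈ (g · (h · x))

record IsRegular {G : Group c ℓ} {X : Setoid a r} (A : Action G X) :
                 Set (c ⊔ ℓ ⊔ a ⊔ r) where
  private
    module G = Group G
    module X = Setoid X
  open Action A
  field
    transitive         : ∀ x y → ∃ λ g → (g · x) X.≈ y
    trivialStabilizers : ∀ x g → (g · x) X.≈ x → g G.≈ G.ε

record Graph (a ℓ r : Level) : Set (lsuc (a ⊔ ℓ ⊔ r)) where
  field
    vertices : Setoid a ℓ
  open Setoid vertices public
    renaming (Carrier to Vertex; _≈_ to _≈ᵥ_; _≉_ to _≉ᵥ_)
    using ()
  field
    Adj        : Rel Vertex r
    Adj-resp   : ∀ {u u′ v v′} → u ≈ᵥ u′ → v ≈ᵥ v′ → Adj u v → Adj u′ v′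
    Adj-sym    : ∀ {u v} → Adj u v → Adj v u
    Adj-irrefl : ∀ {u v} → u ≈ᵥ v → ¬ Adj u v

module _ (Γ : Graph a ℓ r) where
  open Graph Γ
  private module V = Setoid vertices

  record Automorphism : Set (a ⊔ ℓ ⊔ r) where
    field
      bijection : Inverse vertices vertices
    open Inverse bijection public using (to; from; to-cong; from-cong)
    field
      adjacency : ∀ u v → Adj u v ⇔ Adj (to u) (to v)

  open Automorphism

  _≈ₐ_ : Rel Automorphism (a ⊔ ℓ)
  φ ≈ₐ ψ = ∀ v → to φ v ≈ᵥ to ψ v

  private
    to∘from : ∀ φ v → to φ (from φ v) ≈ᵥ v
    to∘from φ = Inverse.strictlyInverseˡ (bijection φ)

    from∘to : ∀ φ v → from φ (to φ v) ≈ᵥ v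
    from∘to φ = Inverse.strictlyInverseʳ (bijection φ)

  _∘ₐ_ : Automorphism → Automorphism → Automorphism
  φ ∘ₐ ψ = record
    { bijection = Composition.inverse (bijection ψ) (bijection φ)
    ; adjacency = λ u v → Composition._⇔-∘_
        (adjacency φ (to ψ u) (to ψ v)) (adjacency ψ u v)
    }

  idₐ : Automorphism
  idₐ = record
    { bijection = Identity.inverse vertices
    ; adjacency = λ u v → Identity.⇔-id _
    }

  invₐ : Automorphism → Automorphism
  invₐ φ = record
    { bijection = Symmetry.inverse (bijection φ)
    ; adjacency = λ u v → mk⇔
        (λ uv → Equivalence.from (adjacency φ (from φ u) (from φ v))
                  (Adj-resp (V.sym (to∘from φ u)) (V.sym (to∘from φ v)) uv))
        (λ uv → Adj-resp (to∘from φ u) (to∘from φ v)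
                  (Equivalence.to (adjacency φ (from φ u) (from φ v)) uv))
    }

  Aut : Group (a ⊔ ℓ ⊔ r) (a ⊔ ℓ)
  Aut = record
    { Carrier = Automorphism
    ; _≈_     = _≈ₐ_
    ; _∙_     = _∘ₐ_
    ; ε       = idₐ
    ; _⁻¹     = invₐ
    ; isGroup = record
      { isMonoid = record
        { isSemigroup = record
          { isMagma = record
            { isEquivalence = record
              { refl  = λ _ → V.refl
              ; sym   = λ φ≈ψ v → V.sym (φ≈ψ v)
              ; trans = λ φ≈ψ ψ≈χ v → V.trans (φ≈ψ v) (ψ≈χ v)
              }
            ; ∙-cong = λ {φ} {φ′} {ψ} {ψ′} φ≈φ′ ψ≈ψ′ v →
                V.trans (to-cong φ (ψ≈ψ′ v)) (φ≈φ′ (to ψ′ v))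
            }
          ; assoc = λ _ _ _ _ → V.refl
          }
        ; identity = (λ _ _ → V.refl) , (λ _ _ → V.refl)
        }
      ; inverse = from∘to , to∘from
      ; ⁻¹-cong = λ {φ} {ψ} φ≈ψ v →
          V.trans (V.sym (from∘to ψ (from φ v)))
                  (from-cong ψ (V.trans (V.sym (φ≈ψ (from φ v))) (to∘from φ v)))
      }
    }

  record 3-Arc : Set (a ⊔ ℓ ⊔ r) where
    field
      v₀ v₁ v₂ v₃ : Vertex
      v₀~v₁ : Adj v₀ v₁
      v₁~v₂ : Adj v₁ v₂
      v₂~v₃ : Adj v₂ v₃
      v₀≉v₂ : v₀ ≉ᵥ v₂
      v₁≉v₃ : v₁ ≉ᵥ v₃

  3-arcs : Setoid (a ⊔ ℓ ⊔ r) ℓ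
  3-arcs = record
    { Carrier       = 3-Arc
    ; _≈_           = λ s t → v₀ s ≈ᵥ v₀ t × v₁ s ≈ᵥ v₁ t
                            × v₂ s ≈ᵥ v₂ t × v₃ s ≈ᵥ v₃ t
    ; isEquivalence = record
      { refl  = V.refl , V.refl , V.refl , V.refl
      ; sym   = λ (e₀ , e₁ , e₂ , e₃) → V.sym e₀ , V.sym e₁ , V.sym e₂ , V.sym e₃
      ; trans = λ (e₀ , e₁ , e₂ , e₃) (f₀ , f₁ , f₂ , f₃) →
          V.trans e₀ f₀ , V.trans e₁ f₁ , V.trans e₂ f₂ , V.trans e₃ f₃
      }
    }
    where open 3-Arc

  to-injective : ∀ φ {u v} → to φ u ≈ᵥ to φ v → u ≈ᵥ v
  to-injective φ {u} {v} eq =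
    V.trans (V.sym (from∘to φ u)) (V.trans (from-cong φ eq) (from∘to φ v))

  3-arcAction : Action Aut 3-arcs
  3-arcAction = record
    { _·_    = λ φ s → let open 3-Arc s in record
      { v₀ = to φ v₀ ; v₁ = to φ v₁ ; v₂ = to φ v₂ ; v₃ = to φ v₃
      ; v₀~v₁ = Equivalence.to (adjacency φ _ _) v₀~v₁
      ; v₁~v₂ = Equivalence.to (adjacency φ _ _) v₁~v₂
      ; v₂~v₃ = Equivalence.to (adjacency φ _ _) v₂~v₃
      ; v₀≉v₂ = λ eq → v₀≉v₂ (to-injective φ eq)
      ; v₁≉v₃ = λ eq → v₁≉v₃ (to-injective φ eq)
      }
    ; ·-cong = λ {φ} {ψ} φ≈ψ (e₀ , e₁ , e₂ , e₃) →
        let step : ∀ {u v} → u ≈ᵥ v → to φ u ≈ᵥ to ψ v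
            step e = V.trans (to-cong φ e) (φ≈ψ _)
        in step e₀ , step e₁ , step e₂ , step e₃
    ; ·-ε    = λ _ → V.refl , V.refl , V.refl , V.refl
    ; ·-∙    = λ _ _ _ → V.refl , V.refl , V.refl , V.refl
    }

  3-ArcRegular : Set (a ⊔ ℓ ⊔ r)
  3-ArcRegular = IsRegular 3-arcAction

module RawGroupOperations (G : RawGroup c ℓ) where
  open RawGroup G
  open RawMonoidDefinitions rawMonoid using () renaming (_×_ to _times_)

  infixr 8 _^_ _^ᶻ_

  _^_ : Carrier → ℕ → Carrier
  x ^ n = n times x

  _^ᶻ_ : Carrier → ℤ → Carrier
  x ^ᶻ (+ n)    = x ^ n
  x ^ᶻ -[1+ n ] = (x ^ suc n) ⁻¹

  [_,_] : Carrier → Carrier → Carrier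
  [ x , y ] = x ⁻¹ ∙ y ⁻¹ ∙ x ∙ y

module _ (G : Group c ℓ) where
  open Group G
  open RawGroupOperations rawGroup

  cyclic : Carrier → Pred Carrier ℓ
  cyclic x z = ∃ λ (k : ℤ) → z ≈ x ^ᶻ k

  rightCoset : Pred Carrier d → Carrier → Pred Carrier (c ⊔ ℓ ⊔ d)
  rightCoset H g z = ∃ λ h → H h × z ≈ h ∙ g

data CosetRep (A : Set a) : Set a where
  H-coset K-coset : A → CosetRep A

module _ (G : Group c ℓ) (H K : Pred (Group.Carrier G) d) where
  open Group G using (Carrier)

  ⟦_⟧ : CosetRep Carrier → Pred Carrier (c ⊔ ℓ ⊔ d)
  ⟦ H-coset g ⟧ = rightCoset G H g
  ⟦ K-coset g ⟧ = rightCoset G K g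

  -- A vertex is a coset given by a representative; vertices are equal when
  -- they are equal as subsets of G, so this is the union, not the disjoint
  -- union, of the two families of cosets.
  cosetSetoid : Setoid c (c ⊔ ℓ ⊔ d)
  cosetSetoid = record
    { Carrier       = CosetRep Carrier
    ; _≈_           = λ u v → ⟦ u ⟧ ≐ ⟦ v ⟧
    ; isEquivalence = record { refl = ≐-refl ; sym = ≐-sym ; trans = ≐-trans }
    }

  MeetingPair : Rel (CosetRep Carrier) (c ⊔ ℓ ⊔ d)
  MeetingPair u v = ∃₂ λ g h → ⟦ u ⟧ ≐ ⟦ H-coset g ⟧ × ⟦ v ⟧ ≐ ⟦ K-coset h ⟧
                             × Satisfiable (rightCoset G H g ∩ rightCoset G K h)

  Cos : (∀ g h → ¬ (rightCoset G H g ≐ rightCoset G K h)) →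
        Graph c (c ⊔ ℓ ⊔ d) (c ⊔ ℓ ⊔ d)
  Cos distinct = record
    { vertices   = cosetSetoid
    ; Adj        = λ u v → MeetingPair u v ⊎ MeetingPair v u
    ; Adj-resp   = λ {u} {u′} {v} {v′} → adj-resp u u′ v v′
    ; Adj-sym    = λ where
        (inj₁ m) → inj₂ m
        (inj₂ m) → inj₁ m
    ; Adj-irrefl = λ {u} {v} → adj-irrefl u v
    }
    where
    resp : ∀ u u′ v v′ → ⟦ u ⟧ ≐ ⟦ u′ ⟧ → ⟦ v ⟧ ≐ ⟦ v′ ⟧ →
           MeetingPair u v → MeetingPair u′ v′
    resp _ _ _ _ u≈u′ v≈v′ (g , h , u≈Hg , v≈Kh , meet) =
      g , h , ≐-trans (≐-sym u≈u′) u≈Hg , ≐-trans (≐-sym v≈v′) v≈Kh , meet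

    adj-resp : ∀ u u′ v v′ → ⟦ u ⟧ ≐ ⟦ u′ ⟧ → ⟦ v ⟧ ≐ ⟦ v′ ⟧ →
               MeetingPair u v ⊎ MeetingPair v u →
               MeetingPair u′ v′ ⊎ MeetingPair v′ u′
    adj-resp u u′ v v′ u≈u′ v≈v′ (inj₁ m) = inj₁ (resp u u′ v v′ u≈u′ v≈v′ m)
    adj-resp u u′ v v′ u≈u′ v≈v′ (inj₂ m) = inj₂ (resp v v′ u u′ v≈v′ u≈u′ m)

    irrefl : ∀ u v → ⟦ u ⟧ ≐ ⟦ v ⟧ → ¬ MeetingPair u v
    irrefl _ _ u≈v (g , h , u≈Hg , v≈Kh , _) =
      distinct g h (≐-trans (≐-sym u≈Hg) (≐-trans u≈v v≈Kh))

    adj-irrefl : ∀ u v → ⟦ u ⟧ ≐ ⟦ v ⟧ → ¬ (MeetingPair u v ⊎ MeetingPair v u)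
    adj-irrefl u v u≈v (inj₁ m) = irrefl u v u≈v m
    adj-irrefl u v u≈v (inj₂ m) = irrefl v u (≐-sym u≈v) m

module _ (X : Set a) where

  infixl 7 _∙_
  infix  8 _⁻¹

  data Word : Set a where
    gen : X → Word
    ε   : Word
    _∙_ : Word → Word → Word
    _⁻¹ : Word → Word

  wordRawGroup : RawGroup a a
  wordRawGroup = record { Carrier = Word ; _≈_ = _≡_ ; _∙_ = _∙_ ; ε = ε ; _⁻¹ = _⁻¹ }

module _ {X : Set a} (R : Rel (Word X) r) where

  infix 4 _∼_

  data _∼_ : Rel (Word X) (a ⊔ r) where
    relation  : ∀ {u v} → R u v → u ∼ v
    ∼-refl    : ∀ {u} → u ∼ u
    ∼-sym     : ∀ {u v} → u ∼ v → v ∼ u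
    ∼-trans   : ∀ {u v w} → u ∼ v → v ∼ w → u ∼ w
    ∙-cong    : ∀ {u u′ v v′} → u ∼ u′ → v ∼ v′ → u ∙ v ∼ u′ ∙ v′
    ⁻¹-cong   : ∀ {u v} → u ∼ v → u ⁻¹ ∼ v ⁻¹
    assoc     : ∀ u v w → (u ∙ v) ∙ w ∼ u ∙ (v ∙ w)
    identityˡ : ∀ u → ε ∙ u ∼ u
    identityʳ : ∀ u → u ∙ ε ∼ u
    inverseˡ  : ∀ u → u ⁻¹ ∙ u ∼ ε
    inverseʳ  : ∀ u → u ∙ u ⁻¹ ∼ ε

  presentedGroup : Group a (a ⊔ r)
  presentedGroup = record
    { Carrier = Word X
    ; _≈_     = _∼_
    ; _∙_     = _∙_
    ; ε       = ε
    ; _⁻¹     = _⁻¹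
    ; isGroup = record
      { isMonoid = record
        { isSemigroup = record
          { isMagma = record
            { isEquivalence = record { refl = ∼-refl ; sym = ∼-sym ; trans = ∼-trans }
            ; ∙-cong        = ∙-cong
            }
          ; assoc = assoc
          }
        ; identity = identityˡ , identityʳ
        }
      ; inverse = inverseˡ , inverseʳ
      ; ⁻¹-cong = ⁻¹-cong
      }
    }

data Generator : Set where
  𝕒 𝕓 𝕔 : Generator

open RawGroupOperations (wordRawGroup Generator)

data Relator (p : ℕ) : Rel (Word Generator) 0ℓ where
  aᵖ=1    : Relator p (gen 𝕒 ^ p) ε
  bᵖ=1    : Relator p (gen 𝕓 ^ p) ε
  cᵖ=1    : Relator p (gen 𝕔 ^ p) ε
  [a,b]=c : Relator p [ gen 𝕒 , gen 𝕓 ] (gen 𝕔)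
  [c,a]=1 : Relator p [ gen 𝕔 , gen 𝕒 ] ε
  [c,b]=1 : Relator p [ gen 𝕔 , gen 𝕓 ] ε

𝔾 : ℕ → Group 0ℓ 0ℓ
𝔾 p = presentedGroup (Relator p)

⟨a⟩ ⟨b⟩ : ∀ p → Pred (Word Generator) 0ℓ
⟨a⟩ p = cyclic (𝔾 p) (gen 𝕒)
⟨b⟩ p = cyclic (𝔾 p) (gen 𝕓)

-- The exponent sum of a is well defined modulo p, which separates the cosets
-- of ⟨a⟩ from those of ⟨b⟩ and hence makes the coset graph loopless.
private
  expₐ : Word Generator → ℤ
  expₐ (gen 𝕒) = 1ℤ
  expₐ (gen 𝕓) = 0ℤ
  expₐ (gen 𝕔) = 0ℤ
  expₐ ε       = 0ℤ
  expₐ (u ∙ v) = expₐ u ℤ.+ expₐ v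
  expₐ (u ⁻¹)  = ℤ.- expₐ u

  expₐ-a^ : ∀ n → expₐ (gen 𝕒 ^ n) ≡ + n
  expₐ-a^ zero    = ≡.refl
  expₐ-a^ (suc n) = ≡.cong (λ k → 1ℤ ℤ.+ k) (expₐ-a^ n)

  expₐ-x^ : ∀ x → expₐ x ≡ 0ℤ → ∀ n → expₐ (x ^ n) ≡ 0ℤ
  expₐ-x^ x x≡0 zero    = ≡.refl
  expₐ-x^ x x≡0 (suc n) = ≡.cong₂ ℤ._+_ x≡0 (expₐ-x^ x x≡0 n)

  module _ (p : ℕ) where

    private module 𝔾ₚ = RawGroupOperations (Group.rawGroup (𝔾 p))

    expₐ-b^ : ∀ n → expₐ (gen 𝕓 𝔾ₚ.^ n) ≡ 0ℤ
    expₐ-b^ zero    = ≡.refl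
    expₐ-b^ (suc n) = ≡.cong (λ k → 0ℤ ℤ.+ k) (expₐ-b^ n)

    expₐ-b^ᶻ : ∀ k → expₐ (gen 𝕓 𝔾ₚ.^ᶻ k) ≡ 0ℤ
    expₐ-b^ᶻ (+ n)    = expₐ-b^ n
    expₐ-b^ᶻ -[1+ n ] = ≡.cong ℤ.-_ (expₐ-b^ (suc n))

    infix 4 _≡ₚ_
    record _≡ₚ_ (i j : ℤ) : Set where
      constructor mod
      field difference : (+ p) ℤ∣.∣ (i ℤ.- j)

    subst∣ : ∀ {i j} → i ≡ j → (+ p) ℤ∣.∣ i → (+ p) ℤ∣.∣ j
    subst∣ ≡.refl p∣i = p∣i

    ≡⇒≡ₚ : ∀ {i j} → i ≡ j → i ≡ₚ j
    ≡⇒≡ₚ {i} ≡.refl = mod (subst∣ (≡.sym (ℤ.+-inverseʳ i)) (ℤ∣.divides 0ℤ ≡.refl))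

    p≡ₚ0 : + p ≡ₚ 0ℤ
    p≡ₚ0 = mod (subst∣ (≡.sym (ℤ.+-identityʳ (+ p))) ℤ∣.∣-refl)

    ≡ₚ-sym : ∀ {i j} → i ≡ₚ j → j ≡ₚ i
    ≡ₚ-sym {i} {j} (mod e) = mod (subst∣ (eq i j) (ℤ∣.∣m⇒∣-m e))
      where
      eq : ∀ i j → ℤ.- (i ℤ.- j) ≡ j ℤ.- i
      eq = solve-∀

    ≡ₚ-trans : ∀ {i j k} → i ≡ₚ j → j ≡ₚ k → i ≡ₚ k
    ≡ₚ-trans {i} {j} {k} (mod e) (mod f) = mod (subst∣ (eq i j k) (ℤ∣.∣m∣n⇒∣m+n e f))
      where
      eq : ∀ i j k → (i ℤ.- j) ℤ.+ (j ℤ.- k) ≡ i ℤ.- k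
      eq = solve-∀

    ≡ₚ-+ : ∀ {i i′ j j′} → i ≡ₚ i′ → j ≡ₚ j′ → i ℤ.+ j ≡ₚ i′ ℤ.+ j′
    ≡ₚ-+ {i} {i′} {j} {j′} (mod e) (mod f) =
      mod (subst∣ (eq i i′ j j′) (ℤ∣.∣m∣n⇒∣m+n e f))
      where
      eq : ∀ i i′ j j′ → (i ℤ.- i′) ℤ.+ (j ℤ.- j′) ≡ (i ℤ.+ j) ℤ.- (i′ ℤ.+ j′)
      eq = solve-∀

    ≡ₚ-neg : ∀ {i j} → i ≡ₚ j → ℤ.- i ≡ₚ ℤ.- j
    ≡ₚ-neg {i} {j} (mod e) = mod (subst∣ (eq i j) (ℤ∣.∣m⇒∣-m e))
      where
      eq : ∀ i j → ℤ.- (i ℤ.- j) ≡ (ℤ.- i) ℤ.- (ℤ.- j)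
      eq = solve-∀

    expₐ-cong : ∀ {u v} → Group._≈_ (𝔾 p) u v → expₐ u ≡ₚ expₐ v
    expₐ-cong (relation aᵖ=1)    = ≡ₚ-trans (≡⇒≡ₚ (expₐ-a^ p)) p≡ₚ0
    expₐ-cong (relation bᵖ=1)    = ≡⇒≡ₚ (expₐ-x^ (gen 𝕓) ≡.refl p)
    expₐ-cong (relation cᵖ=1)    = ≡⇒≡ₚ (expₐ-x^ (gen 𝕔) ≡.refl p)
    expₐ-cong (relation [a,b]=c) = ≡⇒≡ₚ ≡.refl
    expₐ-cong (relation [c,a]=1) = ≡⇒≡ₚ ≡.refl
    expₐ-cong (relation [c,b]=1) = ≡⇒≡ₚ ≡.refl
    expₐ-cong ∼-refl             = ≡⇒≡ₚ ≡.refl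
    expₐ-cong (∼-sym e)          = ≡ₚ-sym (expₐ-cong e)
    expₐ-cong (∼-trans e f)      = ≡ₚ-trans (expₐ-cong e) (expₐ-cong f)
    expₐ-cong (∙-cong e f)       = ≡ₚ-+ (expₐ-cong e) (expₐ-cong f)
    expₐ-cong (⁻¹-cong e)        = ≡ₚ-neg (expₐ-cong e)
    expₐ-cong (assoc u v w)      = ≡⇒≡ₚ (ℤ.+-assoc (expₐ u) (expₐ v) (expₐ w))
    expₐ-cong (identityˡ u)      = ≡⇒≡ₚ (ℤ.+-identityˡ (expₐ u))
    expₐ-cong (identityʳ u)      = ≡⇒≡ₚ (ℤ.+-identityʳ (expₐ u))
    expₐ-cong (inverseˡ u)       = ≡⇒≡ₚ (ℤ.+-inverseˡ (expₐ u))
    expₐ-cong (inverseʳ u)       = ≡⇒≡ₚ (ℤ.+-inverseʳ (expₐ u))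

    expₐ-⟨b⟩coset : ∀ {h z} → rightCoset (𝔾 p) (⟨b⟩ p) h z → expₐ z ≡ₚ expₐ h
    expₐ-⟨b⟩coset {h} (y , (k , y∼bᵏ) , z∼yh) = ≡ₚ-trans (expₐ-cong z∼yh)
      (≡ₚ-trans (≡ₚ-+ (≡ₚ-trans (expₐ-cong y∼bᵏ) (≡⇒≡ₚ (expₐ-b^ᶻ k))) (≡⇒≡ₚ ≡.refl))
                (≡⇒≡ₚ (ℤ.+-identityˡ (expₐ h))))

⟨a⟩g≠⟨b⟩h : ∀ {p} → Prime p → ∀ g h →
            ¬ (rightCoset (𝔾 p) (⟨a⟩ p) g ≐ rightCoset (𝔾 p) (⟨b⟩ p) h)
⟨a⟩g≠⟨b⟩h {p} p-prime g h (⟨a⟩g⊆⟨b⟩h , _) =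
  ¬prime[1] (≡.subst Prime (∣1⇒≡1 (ℤ∣.∣⇒∣ᵤ (subst∣ p (eq (expₐ g)) (_≡ₚ_.difference ag≡g)))) p-prime)
  where
  g∈ : rightCoset (𝔾 p) (⟨a⟩ p) g g
  g∈ = ε , (+ 0 , ∼-refl) , ∼-sym (identityˡ g)

  ag∈ : rightCoset (𝔾 p) (⟨a⟩ p) g (gen 𝕒 ∙ g)
  ag∈ = gen 𝕒 , (+ 1 , ∼-sym (identityʳ (gen 𝕒))) , ∼-refl

  ag≡g : _≡ₚ_ p (1ℤ ℤ.+ expₐ g) (expₐ g)
  ag≡g = ≡ₚ-trans p (expₐ-⟨b⟩coset p (⟨a⟩g⊆⟨b⟩h ag∈))
                    (≡ₚ-sym p (expₐ-⟨b⟩coset p (⟨a⟩g⊆⟨b⟩h g∈)))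

  eq : ∀ i → (1ℤ ℤ.+ i) ℤ.- i ≡ 1ℤ
  eq = solve-∀

heisenbergGraph : ∀ {p} → Prime p → Graph 0ℓ 0ℓ 0ℓ
heisenbergGraph {p} p-prime = Cos (𝔾 p) (⟨a⟩ p) (⟨b⟩ p) (⟨a⟩g≠⟨b⟩h p-prime)

{-# OPTIONS --safe #-}

-- Normal forms bʲ aⁱ cᵏ turn the cosets ⟨a⟩g and ⟨b⟩g into the points (j , k − ij)
-- and the lines [i , k] over the field of p elements, and two of them meet
-- exactly when the point (x , y) lies on the line k = y + m x.  The affine maps
-- preserving this incidence, together with the duality (x , y) ↦ [x , −y], carry
-- the 3-arc (0,0), [0,0], (1,0), [1,1] to every other one.  An automorphism φ
-- fixing that arc preserves points and lines, by connectedness, and maps points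
-- with equal abscissas to such points, these being the pairs without a common
-- neighbour; likewise for lines.  Hence φ(x , y) = (X x , Y x y) and
-- φ[m , k] = [M m , K m k], and incidence gives Y x y = K m y = L y with
-- L (y + m x) = L y + M m · X x.  As L 0 = 0 and X 1 = M 1 = 1, it follows that
-- X = M = L is additive with L 1 = 1, so that φ is the identity.

module Submission where

open import Defs hiding
  (ε; _∙_; _⁻¹; _∼_; ∙-cong; ⁻¹-cong; assoc; identityˡ; identityʳ; inverseˡ; inverseʳ)
open import Data.Nat.Base using (ℕ)
open import Data.Nat.Divisibility using (_∤_)
open import Data.Nat.Primality using (Prime)

open import Algebra.Bundles using (Group)
import Algebra.Properties.Group as GroupProperties
open import Data.Bool.Base using (Bool; true; false; not)
open import Data.Empty using (⊥-elim)
open import Data.Integer.Base using (ℤ; +_; -[1+_]; 0ℤ; 1ℤ; -1ℤ; _+_; _-_; _*_; -_)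
open import Data.Integer.Divisibility.Signed as ℤ∣ using (_∣_; _∣?_; divides; ∣ᵤ⇒∣)
import Data.Integer.Properties as ℤ
open import Data.Integer.Tactic.RingSolver using (solve; solve-∀)
open import Data.List.Base using (_∷_; [])
open import Data.Nat.Base as ℕ using (zero; suc)
open import Data.Nat.Coprimality using (Coprime; coprime-Bézout)
import Data.Nat.Divisibility as ℕ∣
open import Data.Nat.GCD using (module Bézout)
open import Data.Nat.Primality using (prime⇒irreducible; ¬prime[1])
open import Data.Product.Base using (∃; _×_; _,_)
open import Data.Sum.Base using (inj₁; inj₂)
open import Function.Bundles using (Inverse; _⇔_; mk⇔; Equivalence)
open import Function.Consequences.Setoid using (strictlyInverseˡ⇒inverseˡ; strictlyInverseʳ⇒inverseʳ)
import Function.Construct.Composition as Composition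
import Function.Construct.Symmetry as Symmetry
open import Level using (Level; 0ℓ; _⊔_)
open import Relation.Binary.Bundles using (Setoid)
open import Relation.Binary.Core using (Rel)
open import Relation.Binary.PropositionalEquality as ≡ using (_≡_)
import Relation.Binary.Reasoning.Setoid as SetoidReasoning
open import Relation.Nullary.Decidable.Core using (Dec; yes; no; map′)
open import Relation.Nullary.Negation.Core using (¬_)
open import Relation.Unary.Properties using (≐-refl; ≐-sym)

open Bézout using (+-; -+)

private
  variable
    a b c ℓ ℓ₁ ℓ₂ r r₁ r₂ : Level

-- Regularity of a group action, tested at one point

module _ {G : Group c ℓ} {X : Setoid a r} (A : Action G X) where
  private
    module X = Setoid X
  open Group G
  open Action A
  open GroupProperties G

  ⁻¹-moves-back : ∀ {g x y} → (g · x) X.≈ y → (g ⁻¹ · y) X.≈ x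
  ⁻¹-moves-back {g} {x} {y} gx≈y = X.trans (·-cong refl (X.sym gx≈y))
    (X.trans (X.sym (·-∙ (g ⁻¹) g x)) (X.trans (·-cong (inverseˡ g) X.refl) (·-ε x)))

  -- Stabilizers along an orbit are conjugate: if `h` carries `x₀` to `x` and `g` fixes `x`, then
  -- `h ⁻¹ ∙ (g ∙ h)` fixes `x₀`. Transitivity is obtained by passing through `x₀`.
  regular-at : ∀ x₀ → (∀ y → ∃ λ g → (g · x₀) X.≈ y) →
               (∀ g → (g · x₀) X.≈ x₀ → g ≈ ε) → IsRegular A
  regular-at x₀ orbit stabilizer = record
    { transitive = λ x y →
        let g , gx₀≈x = orbit x
            h , hx₀≈y = orbit y
        in h ∙ g ⁻¹ , X.trans (·-∙ h (g ⁻¹) x)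
                        (X.trans (·-cong refl (⁻¹-moves-back gx₀≈x)) hx₀≈y)
    ; trivialStabilizers = λ x g gx≈x →
        let h , hx₀≈x = orbit x
            ghx₀≈x : ((g ∙ h) · x₀) X.≈ x
            ghx₀≈x = X.trans (·-∙ g h x₀) (X.trans (·-cong refl hx₀≈x) gx≈x)
            h⁻¹gh≈ε : h ⁻¹ ∙ (g ∙ h) ≈ ε
            h⁻¹gh≈ε = stabilizer (h ⁻¹ ∙ (g ∙ h))
              (X.trans (·-∙ (h ⁻¹) (g ∙ h) x₀)
                (X.trans (·-cong refl ghx₀≈x) (⁻¹-moves-back hx₀≈x)))
            gh≈h : g ∙ h ≈ h
            gh≈h = trans (inverseʳ-unique (h ⁻¹) (g ∙ h) h⁻¹gh≈ε) (⁻¹-involutive h)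
        in identityˡ-unique g h gh≈h
    }

-- Graph isomorphisms and transport of 3-arc-regularity

record _≅_ (Γ : Graph a ℓ₁ r₁) (Δ : Graph b ℓ₂ r₂) : Set (a ⊔ ℓ₁ ⊔ r₁ ⊔ b ⊔ ℓ₂ ⊔ r₂) where
  private
    module Γ = Graph Γ
    module Δ = Graph Δ
  field
    bijection : Inverse Γ.vertices Δ.vertices
  open Inverse bijection public
    using (to; from; to-cong; from-cong; strictlyInverseˡ; strictlyInverseʳ)
  field
    adjacency : ∀ u v → Γ.Adj u v ⇔ Δ.Adj (to u) (to v)

≅-sym : {Γ : Graph a ℓ₁ r₁} {Δ : Graph b ℓ₂ r₂} → Γ ≅ Δ → Δ ≅ Γ
≅-sym {Γ = Γ} {Δ} θ = record
  { bijection = Symmetry.inverse bijection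
  ; adjacency = λ u v → mk⇔
      (λ uv → Equivalence.from (adjacency (from u) (from v))
                (Δ.Adj-resp (Δᵥ.sym (strictlyInverseˡ u)) (Δᵥ.sym (strictlyInverseˡ v)) uv))
      (λ uv → Δ.Adj-resp (strictlyInverseˡ u) (strictlyInverseˡ v)
                (Equivalence.to (adjacency (from u) (from v)) uv))
  }
  where
  open _≅_ θ
  module Δ = Graph Δ
  module Δᵥ = Setoid Δ.vertices

module _ {Γ : Graph a ℓ₁ r₁} {Δ : Graph b ℓ₂ r₂} (θ : Γ ≅ Δ) where
  private
    module Γ = Graph Γ
    module Δ = Graph Δ
    module Γᵥ = Setoid Γ.vertices
    module Δᵥ = Setoid Δ.vertices
  open _≅_ θ
  open Automorphism using () renaming (to to apply)

  conjugate : Automorphism Δ → Automorphism Γ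
  conjugate φ = record
    { bijection = Composition.inverse bijection
        (Composition.inverse (φ .Automorphism.bijection) (_≅_.bijection (≅-sym θ)))
    ; adjacency = λ u v → Composition._⇔-∘_
        (_≅_.adjacency (≅-sym θ) (apply φ (to u)) (apply φ (to v)))
        (Composition._⇔-∘_ (φ .Automorphism.adjacency (to u) (to v)) (adjacency u v))
    }

  mapArc : 3-Arc Γ → 3-Arc Δ
  mapArc s = record
    { v₀ = to v₀ ; v₁ = to v₁ ; v₂ = to v₂ ; v₃ = to v₃
    ; v₀~v₁ = Equivalence.to (adjacency _ _) v₀~v₁
    ; v₁~v₂ = Equivalence.to (adjacency _ _) v₁~v₂
    ; v₂~v₃ = Equivalence.to (adjacency _ _) v₂~v₃
    ; v₀≉v₂ = λ eq → v₀≉v₂ (θ-injective eq)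
    ; v₁≉v₃ = λ eq → v₁≉v₃ (θ-injective eq)
    }
    where
    open 3-Arc s
    θ-injective : ∀ {u v} → to u Δ.≈ᵥ to v → u Γ.≈ᵥ v
    θ-injective {u} {v} eq = Γᵥ.trans (Γᵥ.sym (strictlyInverseʳ u))
      (Γᵥ.trans (from-cong eq) (strictlyInverseʳ v))

-- An automorphism of `Δ` that moves one image arc to another is conjugated back to `Γ`; an
-- automorphism of `Γ` fixing an arc is conjugated to `Δ`, where regularity makes it the identity.
3-ArcRegular-resp-≅ : {Γ : Graph a ℓ₁ r₁} {Δ : Graph b ℓ₂ r₂} → Γ ≅ Δ →
                      3-ArcRegular Δ → 3-ArcRegular Γ
3-ArcRegular-resp-≅ {Γ = Γ} {Δ} θ regular = record
  { transitive = λ s t →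
      let φ , e₀ , e₁ , e₂ , e₃ = transitive (mapArc θ s) (mapArc θ t)
      in conjugate θ φ , back e₀ , back e₁ , back e₂ , back e₃
  ; trivialStabilizers = λ s φ (e₀ , e₁ , e₂ , e₃) v →
      let θφθ⁻¹≈id = trivialStabilizers (mapArc θ s) (conjugate (≅-sym θ) φ)
            (forth φ e₀ , forth φ e₁ , forth φ e₂ , forth φ e₃)
      -- The conjugation is undone by writing `φ v` as `from (to (φ (from (to v))))`.
      in Γᵥ.trans (Γᵥ.sym (strictlyInverseʳ _))
           (Γᵥ.trans (from-cong (to-cong (apply-cong φ (Γᵥ.sym (strictlyInverseʳ v)))))
             (back (θφθ⁻¹≈id (to v))))
  }
  where
  open _≅_ θ
  open IsRegular regular
  open Automorphism using () renaming (to to apply; to-cong to apply-cong)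
  module Γ = Graph Γ
  module Δ = Graph Δ
  module Γᵥ = Setoid Γ.vertices
  module Δᵥ = Setoid Δ.vertices

  back : ∀ {u v} → u Δ.≈ᵥ to v → from u Γ.≈ᵥ v
  back {v = v} eq = Γᵥ.trans (from-cong eq) (strictlyInverseʳ v)

  forth : ∀ φ {v} → apply φ v Γ.≈ᵥ v → to (apply φ (from (to v))) Δ.≈ᵥ to v
  forth φ {v} eq = to-cong (Γᵥ.trans (apply-cong φ (strictlyInverseʳ v)) eq)

module _ (Γ : Graph a ℓ r) where
  open Graph Γ
  private module V = Setoid vertices

  -- Preservation of adjacency by `from` yields reflection of adjacency by `to`, since `from (to u)`
  -- is `u`.
  automorphism : (to from : Vertex → Vertex) →
                 (∀ {u v} → u ≈ᵥ v → to u ≈ᵥ to v) →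
                 (∀ {u v} → u ≈ᵥ v → from u ≈ᵥ from v) →
                 (∀ v → to (from v) ≈ᵥ v) → (∀ v → from (to v) ≈ᵥ v) →
                 (∀ {u v} → Adj u v → Adj (to u) (to v)) →
                 (∀ {u v} → Adj u v → Adj (from u) (from v)) → Automorphism Γ
  automorphism to from to-cong from-cong to∘from from∘to to-adj from-adj = record
    { bijection = record
      { to = to ; from = from ; to-cong = to-cong ; from-cong = from-cong
      ; inverse = strictlyInverseˡ⇒inverseˡ vertices vertices to-cong to∘from
                , strictlyInverseʳ⇒inverseʳ vertices vertices {f⁻¹ = from} {f = to} from-cong from∘to
      }
    ; adjacency = λ u v → mk⇔ to-adj (λ uv → Adj-resp (from∘to u) (from∘to v) (from-adj uv))
    }

-- Arithmetic modulo p

-- The downward step covers the negative integers: `1ℤ + -1ℤ` computes to `0ℤ` and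
-- `1ℤ + -[1+ suc n ]` to `-[1+ n ]`.
ℤ-induction : {ℓ : Level} (P : ℤ → Set ℓ) → P 0ℤ → (∀ i → P i → P (1ℤ + i)) →
              (∀ i → P (1ℤ + i) → P i) → ∀ i → P i
ℤ-induction P base up down (+ zero)        = base
ℤ-induction P base up down (+ suc n)       = up (+ n) (ℤ-induction P base up down (+ n))
ℤ-induction P base up down -[1+ zero ]     = down -1ℤ base
ℤ-induction P base up down -[1+ suc n ]    = down -[1+ suc n ] (ℤ-induction P base up down -[1+ n ])

i≡i-j+j : ∀ i j → i ≡ i - j + j
i≡i-j+j = solve-∀

pos-1+* : ∀ k l m n → 1 ℕ.+ k ℕ.* l ≡ m ℕ.* n → 1ℤ + + k * + l ≡ + m * + n
pos-1+* k l m n e = ≡.trans (≡.cong (λ i → 1ℤ + i) (≡.sym (ℤ.pos-* k l)))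
  (≡.trans (≡.cong +_ e) (ℤ.pos-* m n))

module Congruence (p : ℕ) where

  infix 4 _≡ₚ_ _≢ₚ_
  -- `ℤ` with this equality serves as the field of `p` elements. The record keeps `i` and `j`
  -- recoverable from the type, which `i - j` alone does not.
  record _≡ₚ_ (i j : ℤ) : Set where
    constructor mod
    field difference : + p ∣ i - j

  _≢ₚ_ : Rel ℤ 0ℓ
  i ≢ₚ j = ¬ i ≡ₚ j

  infixr 6 _⊞_
  infix 7 _⟨*⟩_

  _⟨*⟩_ : ∀ k {i j} → i ≡ₚ j → + p ∣ k * (i - j)
  k ⟨*⟩ mod d = ℤ∣.∣n⇒∣m*n k d

  _⊞_ : ∀ {i j} → + p ∣ i → + p ∣ j → + p ∣ i + j
  _⊞_ = ℤ∣.∣m∣n⇒∣m+n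

  -- A congruence follows from others when its difference is a linear
  -- combination, with integer coefficients, of theirs.
  linear : ∀ {i j d} → + p ∣ d → i - j ≡ d → i ≡ₚ j
  linear p∣d ≡.refl = mod p∣d

  ≡⇒≡ₚ : ∀ {i j} → i ≡ j → i ≡ₚ j
  ≡⇒≡ₚ {i} ≡.refl = linear (divides 0ℤ ≡.refl) (ℤ.+-inverseʳ i)

  ≡ₚ-refl : ∀ {i} → i ≡ₚ i
  ≡ₚ-refl = ≡⇒≡ₚ ≡.refl

  ≡ₚ-sym : ∀ {i j} → i ≡ₚ j → j ≡ₚ i
  ≡ₚ-sym {i} {j} e = linear (-1ℤ ⟨*⟩ e) (solve (i ∷ j ∷ []))

  ≡ₚ-trans : ∀ {i j k} → i ≡ₚ j → j ≡ₚ k → i ≡ₚ k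
  ≡ₚ-trans {i} {j} {k} e f = linear (1ℤ ⟨*⟩ e ⊞ 1ℤ ⟨*⟩ f) (solve (i ∷ j ∷ k ∷ []))

  +-congₚ : ∀ {i i′ j j′} → i ≡ₚ i′ → j ≡ₚ j′ → i + j ≡ₚ i′ + j′
  +-congₚ {i} {i′} {j} {j′} e f =
    linear (1ℤ ⟨*⟩ e ⊞ 1ℤ ⟨*⟩ f) (solve (i ∷ i′ ∷ j ∷ j′ ∷ []))

  *-congₚ : ∀ {i i′ j j′} → i ≡ₚ i′ → j ≡ₚ j′ → i * j ≡ₚ i′ * j′
  *-congₚ {i} {i′} {j} {j′} e f =
    linear (j ⟨*⟩ e ⊞ i′ ⟨*⟩ f) (solve (i ∷ i′ ∷ j ∷ j′ ∷ []))

  +-congˡₚ : ∀ i {j k} → j ≡ₚ k → i + j ≡ₚ i + k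
  +-congˡₚ i e = +-congₚ {i} ≡ₚ-refl e

  +-congʳₚ : ∀ i {j k} → j ≡ₚ k → j + i ≡ₚ k + i
  +-congʳₚ i e = +-congₚ {j = i} e ≡ₚ-refl

  *-congˡₚ : ∀ i {j k} → j ≡ₚ k → i * j ≡ₚ i * k
  *-congˡₚ i e = *-congₚ {i} ≡ₚ-refl e

  *-congʳₚ : ∀ i {j k} → j ≡ₚ k → j * i ≡ₚ k * i
  *-congʳₚ i e = *-congₚ {j = i} e ≡ₚ-refl

  neg-congₚ : ∀ {i j} → i ≡ₚ j → - i ≡ₚ - j
  neg-congₚ {i} {j} e = linear (-1ℤ ⟨*⟩ e) (solve (i ∷ j ∷ []))

  +-cancelˡₚ : ∀ i {j k} → i + j ≡ₚ i + k → j ≡ₚ k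
  +-cancelˡₚ i {j} {k} e = linear (1ℤ ⟨*⟩ e) (solve (i ∷ j ∷ k ∷ []))

  infix 4 _≡ₚ?_
  _≡ₚ?_ : ∀ i j → Dec (i ≡ₚ j)
  i ≡ₚ? j = map′ mod _≡ₚ_.difference (+ p ∣? i - j)

  module _ (p-prime : Prime p) where

    1≢ₚ0 : 1ℤ ≢ₚ 0ℤ
    1≢ₚ0 (mod p∣1) = ¬prime[1] (≡.subst Prime (ℕ∣.∣1⇒≡1 (ℤ∣.∣⇒∣ᵤ p∣1)) p-prime)

    -- A common divisor of `n` and the prime `p` is `1` or `p`, and `+ n ≢ₚ 0ℤ` excludes `p`.
    -- Bézout's identity then gives the inverse; its two forms over `ℕ` differ in the sign of the
    -- coefficient of `n`.
    inverse-ℕ : ∀ n → + n ≢ₚ 0ℤ → ∃ λ j → j * + n ≡ₚ 1ℤ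
    inverse-ℕ n n≢0 with coprime-Bézout n-coprime
      where
      n-coprime : Coprime n p
      n-coprime (d∣n , d∣p) with prime⇒irreducible p-prime d∣p
      ... | inj₁ d≡1    = d≡1
      ... | inj₂ ≡.refl = ⊥-elim (n≢0 (linear (∣ᵤ⇒∣ d∣n) (ℤ.+-identityʳ (+ n))))
    ... | +- x y 1+yp≡xn = + x , linear (divides (+ y) ≡.refl)
            (≡.trans (≡.cong (_- 1ℤ) (≡.sym (pos-1+* y p x n 1+yp≡xn))) (1+i-1≡i (+ y * + p)))
      where
      1+i-1≡i : ∀ i → 1ℤ + i - 1ℤ ≡ i
      1+i-1≡i = solve-∀
    ... | -+ x y 1+xn≡yp = - + x , linear (divides (- + y) ≡.refl)
            (≡.trans (negated (+ x) (+ n))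
              (≡.trans (≡.cong -_ (pos-1+* x n y p 1+xn≡yp)) (ℤ.neg-distribˡ-* (+ y) (+ p))))
      where
      negated : ∀ i j → (- i) * j - 1ℤ ≡ - (1ℤ + i * j)
      negated = solve-∀

    inverse : ∀ i → i ≢ₚ 0ℤ → ∃ λ j → j * i ≡ₚ 1ℤ
    inverse (+ n)    i≢0 = inverse-ℕ n i≢0
    inverse -[1+ n ] i≢0 =
      let j , e = inverse-ℕ (suc n) (λ e → i≢0 (neg-congₚ e))
      in - j , ≡ₚ-trans (≡⇒≡ₚ (eq j (+ suc n))) e
      where
      eq : ∀ j k → (- j) * (- k) ≡ j * k
      eq = solve-∀

    difference≢0 : ∀ {i j} → i ≢ₚ j → i - j ≢ₚ 0ℤ
    difference≢0 {i} {j} i≢j e = i≢j (linear (1ℤ ⟨*⟩ e) (solve (i ∷ j ∷ [])))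

-- The biaffine plane

module BiaffinePlane (p : ℕ) where
  open Congruence p public

  data Vertex : Set where
    point line : ℤ → ℤ → Vertex

  infix 4 _≈_ _~_

  data _≈_ : Rel Vertex 0ℓ where
    point : ∀ {x x′ y y′} → x ≡ₚ x′ → y ≡ₚ y′ → point x y ≈ point x′ y′
    line  : ∀ {m m′ k k′} → m ≡ₚ m′ → k ≡ₚ k′ → line m k ≈ line m′ k′

  -- `line m k` is the affine line `y = k - m x`, of slope `- m`. Vertical lines are absent, so
  -- points with equal abscissas are not joined, just as parallel lines do not meet.
  data _~_ : Rel Vertex 0ℓ where
    point~line : ∀ {x y m k} → k ≡ₚ y + m * x → point x y ~ line m k
    line~point : ∀ {x y m k} → k ≡ₚ y + m * x → line m k ~ point x y

  ≈-refl : ∀ {v} → v ≈ v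
  ≈-refl {point _ _} = point ≡ₚ-refl ≡ₚ-refl
  ≈-refl {line _ _}  = line ≡ₚ-refl ≡ₚ-refl

  ≈-sym : ∀ {u v} → u ≈ v → v ≈ u
  ≈-sym (point e f) = point (≡ₚ-sym e) (≡ₚ-sym f)
  ≈-sym (line e f)  = line (≡ₚ-sym e) (≡ₚ-sym f)

  ≈-trans : ∀ {u v w} → u ≈ v → v ≈ w → u ≈ w
  ≈-trans (point e f) (point e′ f′) = point (≡ₚ-trans e e′) (≡ₚ-trans f f′)
  ≈-trans (line e f)  (line e′ f′)  = line (≡ₚ-trans e e′) (≡ₚ-trans f f′)

  incident-resp : ∀ {x x′ y y′ m m′ k k′} → x ≡ₚ x′ → y ≡ₚ y′ → m ≡ₚ m′ → k ≡ₚ k′ →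
                  k ≡ₚ y + m * x → k′ ≡ₚ y′ + m′ * x′
  incident-resp x≡ y≡ m≡ k≡ e =
    ≡ₚ-trans (≡ₚ-sym k≡) (≡ₚ-trans e (+-congₚ y≡ (*-congₚ m≡ x≡)))

  ~-resp : ∀ {u u′ v v′} → u ≈ u′ → v ≈ v′ → u ~ v → u′ ~ v′
  ~-resp (point x≡ y≡) (line m≡ k≡) (point~line e) = point~line (incident-resp x≡ y≡ m≡ k≡ e)
  ~-resp (line m≡ k≡) (point x≡ y≡) (line~point e) = line~point (incident-resp x≡ y≡ m≡ k≡ e)

  ~-sym : ∀ {u v} → u ~ v → v ~ u
  ~-sym (point~line e) = line~point e
  ~-sym (line~point e) = point~line e

  ~-irrefl : ∀ {u v} → u ≈ v → ¬ u ~ v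
  ~-irrefl (point _ _) ()
  ~-irrefl (line _ _)  ()

  plane : Graph 0ℓ 0ℓ 0ℓ
  plane = record
    { vertices   = record
      { Carrier       = Vertex
      ; _≈_           = _≈_
      ; isEquivalence = record { refl = ≈-refl ; sym = ≈-sym ; trans = ≈-trans }
      }
    ; Adj        = _~_
    ; Adj-resp   = ~-resp
    ; Adj-sym    = ~-sym
    ; Adj-irrefl = ~-irrefl
    }

  open Automorphism using (to; from; to-cong; from-cong)

  -- The sign comes from rewriting `k = y + m x` as `- y = - k + x m`, which exchanges the roles of
  -- `x` and `m`. It turns arcs starting at a line into arcs starting at a point.
  duality : Automorphism plane
  duality = automorphism plane dual dual dual-cong dual-cong dual-involutive dual-involutive dual-adj dual-adj
    where
    dual : Vertex → Vertex
    dual (point x y) = line x (- y)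
    dual (line m k)  = point m (- k)

    dual-cong : ∀ {u v} → u ≈ v → dual u ≈ dual v
    dual-cong (point e f) = line e (neg-congₚ f)
    dual-cong (line e f)  = point e (neg-congₚ f)

    dual-involutive : ∀ v → dual (dual v) ≈ v
    dual-involutive (point x y) = point ≡ₚ-refl (≡⇒≡ₚ (ℤ.neg-involutive y))
    dual-involutive (line m k)  = line ≡ₚ-refl (≡⇒≡ₚ (ℤ.neg-involutive k))

    dual-incident : ∀ {x y m k} → k ≡ₚ y + m * x → - y ≡ₚ - k + x * m
    dual-incident {x} {y} {m} {k} e = linear (1ℤ ⟨*⟩ e) (solve (x ∷ y ∷ m ∷ k ∷ []))

    dual-adj : ∀ {u v} → u ~ v → dual u ~ dual v
    dual-adj (point~line {x} {y} {m} {k} e) = line~point (dual-incident {x} {y} {m} {k} e)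
    dual-adj (line~point {x} {y} {m} {k} e) = point~line (dual-incident {x} {y} {m} {k} e)

  module _ (λ₀ λ₁ μ₀ μ₁ x₀ y₀ m₀ : ℤ) (λ₁λ₀≡1 : λ₁ * λ₀ ≡ₚ 1ℤ) (μ₁μ₀≡1 : μ₁ * μ₀ ≡ₚ 1ℤ) where

    -- Incidence forces the ordinates from the abscissas x ↦ λ₀ x + x₀ and
    -- m ↦ μ₀ m + m₀, up to the translation by y₀.
    private
      to′ from′ : Vertex → Vertex
      to′ (point x y) = point (λ₀ * x + x₀) (λ₀ * μ₀ * y - m₀ * λ₀ * x + y₀)
      to′ (line m k)  = line (μ₀ * m + m₀) (λ₀ * μ₀ * k + μ₀ * x₀ * m + (y₀ + m₀ * x₀))
      from′ (point x y) = point (λ₁ * (x - x₀)) (λ₁ * μ₁ * (y - y₀ + m₀ * (x - x₀)))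
      from′ (line m k)  = line (μ₁ * (m - m₀)) (λ₁ * μ₁ * (k - (y₀ + m₀ * x₀) - x₀ * (m - m₀)))

      to′-cong : ∀ {u v} → u ≈ v → to′ u ≈ to′ v
      to′-cong (point {x} {x′} {y} {y′} e f) = point
        (linear (λ₀ ⟨*⟩ e) (solve (λ₀ ∷ x₀ ∷ x ∷ x′ ∷ [])))
        (linear ((λ₀ * μ₀) ⟨*⟩ f ⊞ (- (m₀ * λ₀)) ⟨*⟩ e)
          (solve (λ₀ ∷ μ₀ ∷ m₀ ∷ y₀ ∷ x ∷ x′ ∷ y ∷ y′ ∷ [])))
      to′-cong (line {m} {m′} {k} {k′} e f) = line
        (linear (μ₀ ⟨*⟩ e) (solve (μ₀ ∷ m₀ ∷ m ∷ m′ ∷ [])))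
        (linear ((λ₀ * μ₀) ⟨*⟩ f ⊞ (μ₀ * x₀) ⟨*⟩ e)
          (solve (λ₀ ∷ μ₀ ∷ m₀ ∷ x₀ ∷ y₀ ∷ m ∷ m′ ∷ k ∷ k′ ∷ [])))

      from′-cong : ∀ {u v} → u ≈ v → from′ u ≈ from′ v
      from′-cong (point {x} {x′} {y} {y′} e f) = point
        (linear (λ₁ ⟨*⟩ e) (solve (λ₁ ∷ x₀ ∷ x ∷ x′ ∷ [])))
        (linear ((λ₁ * μ₁) ⟨*⟩ f ⊞ (λ₁ * μ₁ * m₀) ⟨*⟩ e)
          (solve (λ₁ ∷ μ₁ ∷ m₀ ∷ x₀ ∷ y₀ ∷ x ∷ x′ ∷ y ∷ y′ ∷ [])))
      from′-cong (line {m} {m′} {k} {k′} e f) = line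
        (linear (μ₁ ⟨*⟩ e) (solve (μ₁ ∷ m₀ ∷ m ∷ m′ ∷ [])))
        (linear ((λ₁ * μ₁) ⟨*⟩ f ⊞ (- (λ₁ * μ₁ * x₀)) ⟨*⟩ e)
          (solve (λ₁ ∷ μ₁ ∷ m₀ ∷ x₀ ∷ y₀ ∷ m ∷ m′ ∷ k ∷ k′ ∷ [])))

      to′∘from′ : ∀ v → to′ (from′ v) ≈ v
      to′∘from′ (point x y) = point
        (linear ((x - x₀) ⟨*⟩ λ₁λ₀≡1) (solve (λ₀ ∷ λ₁ ∷ x₀ ∷ x ∷ [])))
        -- With `r = λ₁ * λ₀` and `s = μ₁ * μ₀`, the coefficients come from
        -- `r s - 1 = s (r - 1) + (s - 1)`.
        (linear ((μ₁ * μ₀ * (y - y₀ + m₀ * (x - x₀)) - m₀ * (x - x₀)) ⟨*⟩ λ₁λ₀≡1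
                 ⊞ (y - y₀ + m₀ * (x - x₀)) ⟨*⟩ μ₁μ₀≡1)
          (solve (λ₀ ∷ λ₁ ∷ μ₀ ∷ μ₁ ∷ m₀ ∷ x₀ ∷ y₀ ∷ x ∷ y ∷ [])))
      to′∘from′ (line m k)  = line
        (linear ((m - m₀) ⟨*⟩ μ₁μ₀≡1) (solve (μ₀ ∷ μ₁ ∷ m₀ ∷ m ∷ [])))
        (linear ((μ₁ * μ₀ * (k - (y₀ + m₀ * x₀) - x₀ * (m - m₀))) ⟨*⟩ λ₁λ₀≡1
                 ⊞ (k - (y₀ + m₀ * x₀)) ⟨*⟩ μ₁μ₀≡1)
          (solve (λ₀ ∷ λ₁ ∷ μ₀ ∷ μ₁ ∷ m₀ ∷ x₀ ∷ y₀ ∷ m ∷ k ∷ [])))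

      from′∘to′ : ∀ v → from′ (to′ v) ≈ v
      from′∘to′ (point x y) = point
        (linear (x ⟨*⟩ λ₁λ₀≡1) (solve (λ₀ ∷ λ₁ ∷ x₀ ∷ x ∷ [])))
        (linear ((μ₁ * μ₀ * y) ⟨*⟩ λ₁λ₀≡1 ⊞ y ⟨*⟩ μ₁μ₀≡1)
          (solve (λ₀ ∷ λ₁ ∷ μ₀ ∷ μ₁ ∷ m₀ ∷ x₀ ∷ y₀ ∷ x ∷ y ∷ [])))
      from′∘to′ (line m k)  = line
        (linear (m ⟨*⟩ μ₁μ₀≡1) (solve (μ₀ ∷ μ₁ ∷ m₀ ∷ m ∷ [])))
        (linear ((μ₁ * μ₀ * k) ⟨*⟩ λ₁λ₀≡1 ⊞ k ⟨*⟩ μ₁μ₀≡1)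
          (solve (λ₀ ∷ λ₁ ∷ μ₀ ∷ μ₁ ∷ m₀ ∷ x₀ ∷ y₀ ∷ m ∷ k ∷ [])))

      to′-incident : ∀ {x y m k} → k ≡ₚ y + m * x →
        λ₀ * μ₀ * k + μ₀ * x₀ * m + (y₀ + m₀ * x₀) ≡ₚ
        λ₀ * μ₀ * y - m₀ * λ₀ * x + y₀ + (μ₀ * m + m₀) * (λ₀ * x + x₀)
      to′-incident {x} {y} {m} {k} e = linear ((λ₀ * μ₀) ⟨*⟩ e)
        (solve (λ₀ ∷ μ₀ ∷ m₀ ∷ x₀ ∷ y₀ ∷ x ∷ y ∷ m ∷ k ∷ []))

      from′-incident : ∀ {x y m k} → k ≡ₚ y + m * x →
        λ₁ * μ₁ * (k - (y₀ + m₀ * x₀) - x₀ * (m - m₀)) ≡ₚ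
        λ₁ * μ₁ * (y - y₀ + m₀ * (x - x₀)) + μ₁ * (m - m₀) * (λ₁ * (x - x₀))
      from′-incident {x} {y} {m} {k} e = linear ((λ₁ * μ₁) ⟨*⟩ e)
        (solve (λ₁ ∷ μ₁ ∷ m₀ ∷ x₀ ∷ y₀ ∷ x ∷ y ∷ m ∷ k ∷ []))

      to′-adj : ∀ {u v} → u ~ v → to′ u ~ to′ v
      to′-adj (point~line {x} {y} {m} {k} e) = point~line (to′-incident {x} {y} {m} {k} e)
      to′-adj (line~point {x} {y} {m} {k} e) = line~point (to′-incident {x} {y} {m} {k} e)

      from′-adj : ∀ {u v} → u ~ v → from′ u ~ from′ v
      from′-adj (point~line {x} {y} {m} {k} e) = point~line (from′-incident {x} {y} {m} {k} e)
      from′-adj (line~point {x} {y} {m} {k} e) = line~point (from′-incident {x} {y} {m} {k} e)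

    affine : Automorphism plane
    affine = automorphism plane to′ from′ to′-cong from′-cong to′∘from′ from′∘to′ to′-adj from′-adj

-- 3-arc-regularity of the biaffine plane

module _ {p : ℕ} (p-prime : Prime p) where
  open BiaffinePlane p
  open Automorphism using (to; from; to-cong; from-cong; bijection; adjacency)

  baseArc : 3-Arc plane
  baseArc = record
    { v₀ = point 0ℤ 0ℤ ; v₁ = line 0ℤ 0ℤ ; v₂ = point 1ℤ 0ℤ ; v₃ = line 1ℤ 1ℤ
    ; v₀~v₁ = point~line ≡ₚ-refl
    ; v₁~v₂ = line~point ≡ₚ-refl
    ; v₂~v₃ = point~line ≡ₚ-refl
    ; v₀≉v₂ = λ { (point 0≡1 _) → 1≢ₚ0 p-prime (≡ₚ-sym 0≡1) }
    ; v₁≉v₃ = λ { (line 0≡1 _) → 1≢ₚ0 p-prime (≡ₚ-sym 0≡1) }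
    }

  isPoint : Vertex → Bool
  isPoint (point _ _) = true
  isPoint (line _ _)  = false

  abscissa ordinate : Vertex → ℤ
  abscissa (point x _) = x
  abscissa (line m _)  = m
  ordinate (point _ y) = y
  ordinate (line _ k)  = k

  isPoint-cong : ∀ {u v} → u ≈ v → isPoint u ≡ isPoint v
  isPoint-cong (point _ _) = ≡.refl
  isPoint-cong (line _ _)  = ≡.refl

  abscissa-cong : ∀ {u v} → u ≈ v → abscissa u ≡ₚ abscissa v
  abscissa-cong (point e _) = e
  abscissa-cong (line e _)  = e

  ordinate-cong : ∀ {u v} → u ≈ v → ordinate u ≡ₚ ordinate v
  ordinate-cong (point _ e) = e
  ordinate-cong (line _ e)  = e

  coordinates-determine : ∀ {u v} → isPoint u ≡ isPoint v → abscissa u ≡ₚ abscissa v →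
                          ordinate u ≡ₚ ordinate v → u ≈ v
  coordinates-determine {point _ _} {point _ _} _ e f = point e f
  coordinates-determine {line _ _}  {line _ _}  _ e f = line e f

  isPoint-alternates : ∀ {u v} → u ~ v → isPoint v ≡ not (isPoint u)
  isPoint-alternates (point~line _) = ≡.refl
  isPoint-alternates (line~point _) = ≡.refl

  incidence : ∀ {u v} → u ~ v → isPoint u ≡ true →
              ordinate v ≡ₚ ordinate u + abscissa v * abscissa u
  incidence (point~line e) _ = e

  point-unique : ∀ {x x′ y y′ m k} → x ≡ₚ x′ → k ≡ₚ y + m * x → k ≡ₚ y′ + m * x′ → y ≡ₚ y′
  point-unique {x} {x′} {y} {y′} {m} {k} e f g =
    linear (1ℤ ⟨*⟩ g ⊞ -1ℤ ⟨*⟩ f ⊞ (- m) ⟨*⟩ e) (solve (x ∷ x′ ∷ y ∷ y′ ∷ m ∷ k ∷ []))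

  line-unique : ∀ {x y m m′ k k′} → m ≡ₚ m′ → k ≡ₚ y + m * x → k′ ≡ₚ y + m′ * x → k ≡ₚ k′
  line-unique {x} {y} {m} {m′} {k} {k′} e f g =
    linear (1ℤ ⟨*⟩ f ⊞ -1ℤ ⟨*⟩ g ⊞ x ⟨*⟩ e) (solve (x ∷ y ∷ m ∷ m′ ∷ k ∷ k′ ∷ []))

  -- For a fixed `w`, the incidence equation can be solved for the ordinate of a neighbour once its
  -- abscissa is known.
  neighbour-unique : ∀ {u v w} → abscissa u ≡ₚ abscissa v → u ~ w → v ~ w → u ≈ v
  neighbour-unique e (point~line {m = m} f) (point~line g) = point e (point-unique {m = m} e f g)
  neighbour-unique e (line~point {x} {y} f) (line~point g) = line e (line-unique {x} {y} e f g)

  joining-line : ∀ x x′ y y′ i → i * (x - x′) ≡ₚ 1ℤ →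
                 y + i * (y′ - y) * x ≡ₚ y′ + i * (y′ - y) * x′
  joining-line x x′ y y′ i e =
    linear ((y′ - y) ⟨*⟩ e) (solve (x ∷ x′ ∷ y ∷ y′ ∷ i ∷ []))

  meeting-point : ∀ m m′ k k′ i → i * (m - m′) ≡ₚ 1ℤ →
                  k′ ≡ₚ k - m * (i * (k - k′)) + m′ * (i * (k - k′))
  meeting-point m m′ k k′ i e =
    linear ((k - k′) ⟨*⟩ e) (solve (m ∷ m′ ∷ k ∷ k′ ∷ i ∷ []))

  -- Subtracting the two incidence equations leaves `m (x - x′) = y′ - y` for points and
  -- `(m - m′) x = k - k′` for lines; the difference of abscissas is invertible modulo the prime.
  common-neighbour : ∀ {u v} → isPoint u ≡ isPoint v → abscissa u ≢ₚ abscissa v →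
                     ∃ λ w → u ~ w × v ~ w
  common-neighbour {point x y} {point x′ y′} _ x≢x′ =
    let i , e = inverse p-prime (x - x′) (difference≢0 p-prime x≢x′)
    in line (i * (y′ - y)) (y + i * (y′ - y) * x)
     , point~line ≡ₚ-refl , point~line (joining-line x x′ y y′ i e)
  common-neighbour {line m k} {line m′ k′} _ m≢m′ =
    let i , e = inverse p-prime (m - m′) (difference≢0 p-prime m≢m′)
        x     = i * (k - k′)
    in point x (k - m * x)
     , line~point (≡⇒≡ₚ (i≡i-j+j k (m * x))) , line~point (meeting-point m m′ k k′ i e)
  -- Two distinct vertices of the same kind have equal abscissas exactly when
  -- they have no common neighbour, so automorphisms preserve this relation.
  abscissa-preserved : (φ : Automorphism plane) → ∀ {u v} → isPoint (to φ u) ≡ isPoint (to φ v) →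
                       abscissa u ≡ₚ abscissa v → abscissa (to φ u) ≡ₚ abscissa (to φ v)
  abscissa-preserved φ {u} {v} side u≡v with abscissa (to φ u) ≡ₚ? abscissa (to φ v)
  ... | yes e = e
  ... | no  φu≢φv =
    -- A common neighbour `w` of the images pulls back to the common neighbour `from φ w` of `u` and
    -- `v`. Having equal abscissas, these coincide, and so do their images.
    let w , φu~w , φv~w = common-neighbour side φu≢φv
        back : ∀ {t} → to φ t ~ w → t ~ from φ w
        back φt~w = Equivalence.from (adjacency φ _ _)
          (~-resp ≈-refl (≈-sym (Inverse.strictlyInverseˡ (bijection φ) w)) φt~w)
    in abscissa-cong (to-cong φ (neighbour-unique u≡v (back φu~w) (back φv~w)))

  -- The stabilizer of the base arc

  module BaseStabilizer (φ : Automorphism plane)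
    (fixes₀ : to φ (point 0ℤ 0ℤ) ≈ point 0ℤ 0ℤ) (fixes₁ : to φ (line 0ℤ 0ℤ) ≈ line 0ℤ 0ℤ)
    (fixes₂ : to φ (point 1ℤ 0ℤ) ≈ point 1ℤ 0ℤ) (fixes₃ : to φ (line 1ℤ 1ℤ) ≈ line 1ℤ 1ℤ) where

    preserves-~ : ∀ {u v} → u ~ v → to φ u ~ to φ v
    preserves-~ = Equivalence.to (adjacency φ _ _)

    -- Both `u ~ v` and its image switch between points and lines, so agreement of kinds spreads
    -- along walks.
    kind-propagates : ∀ {u v} → u ~ v → isPoint (to φ u) ≡ isPoint u →
                      isPoint (to φ v) ≡ isPoint v
    kind-propagates u~v e = ≡.trans (isPoint-alternates (preserves-~ u~v))
      (≡.trans (≡.cong not e) (≡.sym (isPoint-alternates u~v)))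

    point-to-point : ∀ x y → isPoint (to φ (point x y)) ≡ true
    point-to-point x y =
      -- (0,0) , [-y,0] , (1,y) , [0,y] , (x,y) is a walk.
      kind-propagates {line 0ℤ y} (line~point (≡⇒≡ₚ (solve (x ∷ y ∷ []))))
      (kind-propagates {point 1ℤ y} (point~line (≡⇒≡ₚ (solve (y ∷ []))))
      (kind-propagates {line (- y) 0ℤ} (line~point (≡⇒≡ₚ (solve (y ∷ []))))
      (kind-propagates {point 0ℤ 0ℤ} (point~line (≡⇒≡ₚ (solve (y ∷ [])))) (isPoint-cong fixes₀))))

    line-to-line : ∀ m k → isPoint (to φ (line m k)) ≡ false
    line-to-line m k = kind-propagates {point 0ℤ k}
      (point~line (≡⇒≡ₚ (solve (m ∷ k ∷ [])))) (point-to-point 0ℤ k)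

    X Y M K : ℤ → ℤ → ℤ
    X x y = abscissa (to φ (point x y))
    Y x y = ordinate (to φ (point x y))
    M m k = abscissa (to φ (line m k))
    K m k = ordinate (to φ (line m k))

    X-column : ∀ x y → X x y ≡ₚ X x 0ℤ
    X-column x y = abscissa-preserved φ {point x y} {point x 0ℤ}
      (≡.trans (point-to-point x y) (≡.sym (point-to-point x 0ℤ))) ≡ₚ-refl

    M-column : ∀ m k k′ → M m k ≡ₚ M m k′
    M-column m k k′ = abscissa-preserved φ {line m k} {line m k′}
      (≡.trans (line-to-line m k) (≡.sym (line-to-line m k′))) ≡ₚ-refl

    -- Incidence is preserved by `φ`, and the abscissas of images depend only on the abscissas of
    -- the arguments, so they can be read off at ordinate `0ℤ`.
    ordinate-image : ∀ x y m k → k ≡ y + m * x → K m k ≡ₚ Y x y + M m 0ℤ * X x 0ℤ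
    ordinate-image x y m k e = ≡ₚ-trans
      (incidence (preserves-~ (point~line {x} {y} {m} {k} (≡⇒≡ₚ e))) (point-to-point x y))
      (+-congˡₚ (Y x y) (*-congₚ (M-column m k 0ℤ) (X-column x y)))

    L : ℤ → ℤ
    L = Y 0ℤ

    -- The point `(0 , k)` lies on every line `[m , k]`, and `X 0ℤ 0ℤ` vanishes by `fixes₀`.
    K≡L : ∀ m k → K m k ≡ₚ L k
    K≡L m k = ≡ₚ-trans (ordinate-image 0ℤ k m k (solve (m ∷ k ∷ [])))
      (≡ₚ-trans (+-congˡₚ (L k) (*-congˡₚ (M m 0ℤ) (abscissa-cong fixes₀)))
        (≡⇒≡ₚ (i+j*0≡i (L k) (M m 0ℤ))))
      where
      i+j*0≡i : ∀ i j → i + j * 0ℤ ≡ i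
      i+j*0≡i = solve-∀

    -- The line `[0 , y]` contains every point `(x , y)`, and `M 0ℤ 0ℤ` vanishes by `fixes₁`.
    Y≡L : ∀ x y → Y x y ≡ₚ L y
    Y≡L x y = ≡ₚ-trans (≡ₚ-sym (≡ₚ-trans (ordinate-image x y 0ℤ y (solve (x ∷ y ∷ [])))
      (≡ₚ-trans (+-congˡₚ (Y x y) (*-congʳₚ (X x 0ℤ) (abscissa-cong fixes₁)))
        (≡⇒≡ₚ (ℤ.+-identityʳ (Y x y))))))
      (K≡L 0ℤ y)

    -- With the ordinates of points and lines both expressed by `L`, incidence becomes a functional
    -- equation.
    L-affine : ∀ x y m k → k ≡ y + m * x → L k ≡ₚ L y + M m 0ℤ * X x 0ℤ
    L-affine x y m k e = ≡ₚ-trans (≡ₚ-sym (K≡L m k))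
      (≡ₚ-trans (ordinate-image x y m k e) (+-congʳₚ (M m 0ℤ * X x 0ℤ) (Y≡L x y)))

    L≡M*X : ∀ x m k → k ≡ m * x → L k ≡ₚ M m 0ℤ * X x 0ℤ
    L≡M*X x m k e = ≡ₚ-trans (L-affine x 0ℤ m k (≡.trans e (≡.sym (ℤ.+-identityˡ (m * x)))))
      (≡ₚ-trans (+-congʳₚ (M m 0ℤ * X x 0ℤ) (ordinate-cong fixes₀))
        (≡⇒≡ₚ (ℤ.+-identityˡ (M m 0ℤ * X x 0ℤ))))

    M1≡1 : M 1ℤ 0ℤ ≡ₚ 1ℤ
    M1≡1 = ≡ₚ-trans (M-column 1ℤ 0ℤ 1ℤ) (abscissa-cong fixes₃)

    L≡X : ∀ x → L x ≡ₚ X x 0ℤ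
    L≡X x = ≡ₚ-trans (L≡M*X x 1ℤ x (≡.sym (ℤ.*-identityˡ x)))
      (≡ₚ-trans (*-congʳₚ (X x 0ℤ) M1≡1) (≡⇒≡ₚ (ℤ.*-identityˡ (X x 0ℤ))))

    L≡M : ∀ m → L m ≡ₚ M m 0ℤ
    L≡M m = ≡ₚ-trans (L≡M*X 1ℤ m m (≡.sym (ℤ.*-identityʳ m)))
      (≡ₚ-trans (*-congˡₚ (M m 0ℤ) (abscissa-cong fixes₂)) (≡⇒≡ₚ (ℤ.*-identityʳ (M m 0ℤ))))

    -- This is `L-affine` at `x = m = 1`, where `fixes₂` and `fixes₃` make both factors `1`.
    -- Together with `L 0 = 0` it determines `L` on all integers.
    L-suc : ∀ i → L (1ℤ + i) ≡ₚ 1ℤ + L i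
    L-suc i = ≡ₚ-trans (L-affine 1ℤ i 1ℤ (1ℤ + i) (ℤ.+-comm 1ℤ i))
      (≡ₚ-trans (+-congˡₚ (L i) (*-congₚ M1≡1 (abscissa-cong fixes₂)))
        (≡⇒≡ₚ (ℤ.+-comm (L i) 1ℤ)))

    L≡id : ∀ i → L i ≡ₚ i
    L≡id = ℤ-induction (λ i → L i ≡ₚ i) (ordinate-cong fixes₀)
      (λ i e → ≡ₚ-trans (L-suc i) (+-congˡₚ 1ℤ e))
      (λ i e → +-cancelˡₚ 1ℤ (≡ₚ-trans (≡ₚ-sym (L-suc i)) e))

    identity : ∀ v → to φ v ≈ v
    identity (point x y) = coordinates-determine (point-to-point x y)
      (≡ₚ-trans (X-column x y) (≡ₚ-trans (≡ₚ-sym (L≡X x)) (L≡id x)))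
      (≡ₚ-trans (Y≡L x y) (L≡id y))
    identity (line m k) = coordinates-determine (line-to-line m k)
      (≡ₚ-trans (M-column m k 0ℤ) (≡ₚ-trans (≡ₚ-sym (L≡M m)) (L≡id m)))
      (≡ₚ-trans (K≡L m k) (L≡id k))

  -- The orbit of the base arc

  duality-swaps : ∀ v → isPoint (to duality v) ≡ not (isPoint v)
  duality-swaps (point _ _) = ≡.refl
  duality-swaps (line _ _)  = ≡.refl

  open Action (3-arcAction plane)
  open Setoid (3-arcs plane) using () renaming (_≈_ to _≈ₛ_; trans to ≈ₛ-trans; sym to ≈ₛ-sym)

  -- Vertices with a common neighbour are distinct only if their abscissas are, so `v₀≉v₂` and
  -- `v₁≉v₃` make `x₂ - x₀` and `m₃ - m₀` invertible.
  point-orbit : (s : 3-Arc plane) → isPoint (3-Arc.v₀ s) ≡ true → ∃ λ φ → (φ · baseArc) ≈ₛ s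
  point-orbit record
    { v₀~v₁ = point~line {x₀} {y₀} {m₀} {k₀} e₀
    ; v₁~v₂ = line~point {x₂} {y₂} e₁
    ; v₂~v₃ = point~line {m = m₃} {k₃} e₂
    ; v₀≉v₂ = v₀≉v₂ ; v₁≉v₃ = v₁≉v₃ } _ =
    let x₂≢x₀ : x₂ ≢ₚ x₀
        x₂≢x₀ e = v₀≉v₂ (neighbour-unique (≡ₚ-sym e)
          (point~line {x₀} {y₀} {m₀} {k₀} e₀) (point~line {x₂} {y₂} {m₀} {k₀} e₁))
        m₃≢m₀ : m₃ ≢ₚ m₀
        m₃≢m₀ e = v₁≉v₃ (neighbour-unique (≡ₚ-sym e)
          (line~point {x₂} {y₂} {m₀} {k₀} e₁) (line~point {x₂} {y₂} {m₃} {k₃} e₂))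
        λ₁ , λ₁λ₀≡1 = inverse p-prime (x₂ - x₀) (difference≢0 p-prime x₂≢x₀)
        μ₁ , μ₁μ₀≡1 = inverse p-prime (m₃ - m₀) (difference≢0 p-prime m₃≢m₀)
    -- The scale factors are chosen to send abscissa `1` to `x₂` on points and to `m₃` on lines; the
    -- ordinates then agree by the incidences `e₀`, `e₁`, `e₂`.
    in affine (x₂ - x₀) λ₁ (m₃ - m₀) μ₁ x₀ y₀ m₀ λ₁λ₀≡1 μ₁μ₀≡1
     , point (≡⇒≡ₚ (solve (x₀ ∷ x₂ ∷ []))) (≡⇒≡ₚ (solve (x₀ ∷ x₂ ∷ y₀ ∷ m₀ ∷ m₃ ∷ [])))
     , line (≡⇒≡ₚ (solve (m₀ ∷ m₃ ∷ [])))
         (linear (-1ℤ ⟨*⟩ e₀) (solve (x₀ ∷ x₂ ∷ y₀ ∷ m₀ ∷ m₃ ∷ k₀ ∷ [])))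
     , point (≡⇒≡ₚ (solve (x₀ ∷ x₂ ∷ [])))
         (linear (1ℤ ⟨*⟩ e₁ ⊞ -1ℤ ⟨*⟩ e₀) (solve (x₀ ∷ x₂ ∷ y₀ ∷ y₂ ∷ m₀ ∷ m₃ ∷ k₀ ∷ [])))
     , line (≡⇒≡ₚ (solve (m₀ ∷ m₃ ∷ [])))
         (linear (-1ℤ ⟨*⟩ e₂ ⊞ 1ℤ ⟨*⟩ e₁ ⊞ -1ℤ ⟨*⟩ e₀)
           (solve (x₀ ∷ x₂ ∷ y₀ ∷ y₂ ∷ m₀ ∷ m₃ ∷ k₀ ∷ k₃ ∷ [])))

  orbit : (s : 3-Arc plane) → ∃ λ φ → (φ · baseArc) ≈ₛ s
  orbit s with isPoint (3-Arc.v₀ s) in kind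
  ... | true  = point-orbit s kind
  ... | false =
    -- The dual of an arc from a line starts at a point; the inverse duality brings the result back.
    let φ , e = point-orbit (duality · s) (≡.trans (duality-swaps (3-Arc.v₀ s)) (≡.cong not kind))
        δ⁻¹   = invₐ plane duality
    in _∘ₐ_ plane δ⁻¹ φ
     , ≈ₛ-trans {_∘ₐ_ plane δ⁻¹ φ · baseArc} {δ⁻¹ · (φ · baseArc)} {s} (·-∙ δ⁻¹ φ baseArc)
         (⁻¹-moves-back (3-arcAction plane) {duality} {s} {φ · baseArc}
           (≈ₛ-sym {φ · baseArc} {duality · s} e))

  plane-3-arc-regular : 3-ArcRegular plane
  plane-3-arc-regular = regular-at (3-arcAction plane) baseArc orbit
    λ φ (e₀ , e₁ , e₂ , e₃) → BaseStabilizer.identity φ e₀ e₁ e₂ e₃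

-- Normal forms in the Heisenberg group

module IntegerPowers (G : Group c ℓ) where
  open Group G hiding (_-_)
  open GroupProperties G
  open RawGroupOperations rawGroup
  open SetoidReasoning setoid

  ^-comm : ∀ x n → x ∙ x ^ n ≈ x ^ n ∙ x
  ^-comm x zero    = trans (identityʳ x) (sym (identityˡ x))
  ^-comm x (suc n) = trans (∙-congˡ (^-comm x n)) (sym (assoc x (x ^ n) x))

  -- For negative exponents, inversion reverses products, so the factor `x` must be moved to the
  -- other end of the power.
  ^ᶻ-suc : ∀ x i → x ^ᶻ (1ℤ + i) ≈ x ∙ x ^ᶻ i
  ^ᶻ-suc x (+ n)        = refl
  ^ᶻ-suc x -[1+ zero ]  = sym (trans (∙-congˡ (⁻¹-cong (identityʳ x))) (inverseʳ x))
  ^ᶻ-suc x -[1+ suc n ] = begin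
    w ⁻¹                ≈⟨ \\-leftDividesˡ x (w ⁻¹) ⟨
    x ∙ (x ⁻¹ ∙ w ⁻¹)   ≈⟨ ∙-congˡ (⁻¹-anti-homo-∙ w x) ⟨
    x ∙ (w ∙ x) ⁻¹      ≈⟨ ∙-congˡ (⁻¹-cong (^-comm x (suc n))) ⟨
    x ∙ (x ∙ w) ⁻¹      ∎
    where w = x ^ suc n

  -- Left cancellation of `x` supplies the downward induction step. Identities between powers are
  -- reduced to both sides obeying one recursion.
  recursion-unique : ∀ x (f g : ℤ → Carrier) → f 0ℤ ≈ g 0ℤ →
                     (∀ i → f (1ℤ + i) ≈ x ∙ f i) → (∀ i → g (1ℤ + i) ≈ x ∙ g i) →
                     ∀ i → f i ≈ g i
  recursion-unique x f g f0≈g0 f-suc g-suc = ℤ-induction (λ i → f i ≈ g i) f0≈g0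
    (λ i fi≈gi → trans (f-suc i) (trans (∙-congˡ fi≈gi) (sym (g-suc i))))
    (λ i fsi≈gsi → ∙-cancelˡ x (f i) (g i) (trans (sym (f-suc i)) (trans fsi≈gsi (g-suc i))))

  ^ᶻ-homo-+ : ∀ x i j → x ^ᶻ (i + j) ≈ x ^ᶻ i ∙ x ^ᶻ j
  ^ᶻ-homo-+ x i j = recursion-unique x (λ i → x ^ᶻ (i + j)) (λ i → x ^ᶻ i ∙ x ^ᶻ j)
    (trans (reflexive (≡.cong (x ^ᶻ_) (ℤ.+-identityˡ j))) (sym (identityˡ (x ^ᶻ j))))
    (λ i → trans (reflexive (≡.cong (x ^ᶻ_) (ℤ.+-assoc 1ℤ i j))) (^ᶻ-suc x (i + j)))
    (λ i → trans (∙-congʳ (^ᶻ-suc x i)) (assoc x (x ^ᶻ i) (x ^ᶻ j)))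
    i

  swap-left : ∀ {x y} → x ∙ y ≈ y ∙ x → ∀ z → x ∙ (y ∙ z) ≈ y ∙ (x ∙ z)
  swap-left {x} {y} xy≈yx z = begin
    x ∙ (y ∙ z)  ≈⟨ assoc x y z ⟨
    x ∙ y ∙ z    ≈⟨ ∙-congʳ xy≈yx ⟩
    y ∙ x ∙ z    ≈⟨ assoc y x z ⟩
    y ∙ (x ∙ z)  ∎

  ^ᶻ-commutes : ∀ {x y} → x ∙ y ≈ y ∙ x → ∀ i → x ^ᶻ i ∙ y ≈ y ∙ x ^ᶻ i
  ^ᶻ-commutes {x} {y} xy≈yx = recursion-unique x (λ i → x ^ᶻ i ∙ y) (λ i → y ∙ x ^ᶻ i)
    (trans (identityˡ y) (sym (identityʳ y)))
    (λ i → trans (∙-congʳ (^ᶻ-suc x i)) (assoc x (x ^ᶻ i) y))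
    (λ i → trans (∙-congˡ (^ᶻ-suc x i)) (swap-left (sym xy≈yx) (x ^ᶻ i)))

  ^ᶻ-^ᶻ-commute : ∀ {x y} → x ∙ y ≈ y ∙ x → ∀ i j → x ^ᶻ i ∙ y ^ᶻ j ≈ y ^ᶻ j ∙ x ^ᶻ i
  ^ᶻ-^ᶻ-commute xy≈yx i j = sym (^ᶻ-commutes (sym (^ᶻ-commutes xy≈yx i)) j)

  module _ {p : ℕ} where
    open Congruence p

    ^ᶻ-cong-mod : ∀ {x} → x ^ p ≈ ε → ∀ {i j} → i ≡ₚ j → x ^ᶻ i ≈ x ^ᶻ j
    ^ᶻ-cong-mod {x} xᵖ≈ε {i} {j} (mod (divides q i-j≡qp)) = begin
      x ^ᶻ i                   ≡⟨ ≡.cong (x ^ᶻ_) i≡qp+j ⟩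
      x ^ᶻ (q * + p + j)       ≈⟨ ^ᶻ-homo-+ x (q * + p) j ⟩
      x ^ᶻ (q * + p) ∙ x ^ᶻ j  ≈⟨ ∙-congʳ (multiple q) ⟩
      ε ∙ x ^ᶻ j               ≈⟨ identityˡ (x ^ᶻ j) ⟩
      x ^ᶻ j                   ∎
      where
      i≡qp+j : i ≡ q * + p + j
      i≡qp+j = ≡.trans (i≡i-j+j i j) (≡.cong (_+ j) i-j≡qp)

      multiple : ∀ q → x ^ᶻ (q * + p) ≈ ε
      -- Raising `q` by one multiplies by `x ^ p`, which is `ε`, and the constant `ε` obeys the same
      -- recursion.
      multiple = recursion-unique ε (λ q → x ^ᶻ (q * + p)) (λ _ → ε) refl
        (λ q → begin
          x ^ᶻ ((1ℤ + q) * + p)         ≡⟨ ≡.cong (x ^ᶻ_) (ℤ.suc-* q (+ p)) ⟩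
          x ^ᶻ (+ p + q * + p)          ≈⟨ ^ᶻ-homo-+ x (+ p) (q * + p) ⟩
          x ^ p ∙ x ^ᶻ (q * + p)        ≈⟨ ∙-congʳ xᵖ≈ε ⟩
          ε ∙ x ^ᶻ (q * + p)            ∎)
        (λ _ → sym (identityˡ ε))

  -- The hypotheses say that `z` is the commutator of `a` and `b` and commutes with both: the
  -- subgroup generated by `a` and `b` has nilpotency class at most two.
  module Collection {a b z : Carrier} (ab≈baz : a ∙ b ≈ b ∙ (a ∙ z))
                    (za≈az : z ∙ a ≈ a ∙ z) (zb≈bz : z ∙ b ≈ b ∙ z) where

    -- Conjugation by a sends b to bz, hence bʲ to (bz)ʲ = bʲzʲ.
    a-past-bʲ : ∀ j → a ∙ b ^ᶻ j ≈ b ^ᶻ j ∙ (a ∙ z ^ᶻ j)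
    a-past-bʲ j = begin
      a ∙ b ^ᶻ j                     ≈⟨ //-rightDividesˡ a (a ∙ b ^ᶻ j) ⟨
      a ∙ b ^ᶻ j ∙ a ⁻¹ ∙ a          ≈⟨ ∙-congʳ (conjugate-power j) ⟩
      b ^ᶻ j ∙ z ^ᶻ j ∙ a            ≈⟨ assoc (b ^ᶻ j) (z ^ᶻ j) a ⟩
      b ^ᶻ j ∙ (z ^ᶻ j ∙ a)          ≈⟨ ∙-congˡ (^ᶻ-commutes za≈az j) ⟩
      b ^ᶻ j ∙ (a ∙ z ^ᶻ j)          ∎
      where
      conjugate-b : a ∙ b ≈ b ∙ z ∙ a
      conjugate-b = trans ab≈baz (trans (∙-congˡ (sym za≈az)) (sym (assoc b z a)))

      conjugate-power : ∀ j → a ∙ b ^ᶻ j ∙ a ⁻¹ ≈ b ^ᶻ j ∙ z ^ᶻ j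
      conjugate-power = recursion-unique (b ∙ z)
        (λ j → a ∙ b ^ᶻ j ∙ a ⁻¹) (λ j → b ^ᶻ j ∙ z ^ᶻ j)
        (trans (∙-congʳ (identityʳ a)) (trans (inverseʳ a) (sym (identityˡ ε))))
        (λ j → begin
          a ∙ b ^ᶻ (1ℤ + j) ∙ a ⁻¹        ≈⟨ ∙-congʳ (∙-congˡ (^ᶻ-suc b j)) ⟩
          a ∙ (b ∙ b ^ᶻ j) ∙ a ⁻¹         ≈⟨ ∙-congʳ (assoc a b (b ^ᶻ j)) ⟨
          a ∙ b ∙ b ^ᶻ j ∙ a ⁻¹           ≈⟨ ∙-congʳ (∙-congʳ conjugate-b) ⟩
          b ∙ z ∙ a ∙ b ^ᶻ j ∙ a ⁻¹       ≈⟨ ∙-congʳ (assoc (b ∙ z) a (b ^ᶻ j)) ⟩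
          b ∙ z ∙ (a ∙ b ^ᶻ j) ∙ a ⁻¹     ≈⟨ assoc (b ∙ z) (a ∙ b ^ᶻ j) (a ⁻¹) ⟩
          b ∙ z ∙ (a ∙ b ^ᶻ j ∙ a ⁻¹)     ∎)
        (λ j → begin
          b ^ᶻ (1ℤ + j) ∙ z ^ᶻ (1ℤ + j)     ≈⟨ ∙-cong (^ᶻ-suc b j) (^ᶻ-suc z j) ⟩
          b ∙ b ^ᶻ j ∙ (z ∙ z ^ᶻ j)         ≈⟨ assoc b (b ^ᶻ j) (z ∙ z ^ᶻ j) ⟩
          b ∙ (b ^ᶻ j ∙ (z ∙ z ^ᶻ j))       ≈⟨ ∙-congˡ (swap-left (^ᶻ-commutes (sym zb≈bz) j) (z ^ᶻ j)) ⟩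
          b ∙ (z ∙ (b ^ᶻ j ∙ z ^ᶻ j))       ≈⟨ assoc b z (b ^ᶻ j ∙ z ^ᶻ j) ⟨
          b ∙ z ∙ (b ^ᶻ j ∙ z ^ᶻ j)         ∎)

    -- Each factor `a` that passes `bʲ` leaves one `zʲ` behind, whence the exponent `i * j`.
    aⁱ-past-bʲ : ∀ i j → a ^ᶻ i ∙ b ^ᶻ j ≈ b ^ᶻ j ∙ (a ^ᶻ i ∙ z ^ᶻ (i * j))
    aⁱ-past-bʲ i j = recursion-unique a
      (λ i → a ^ᶻ i ∙ b ^ᶻ j) (λ i → b ^ᶻ j ∙ (a ^ᶻ i ∙ z ^ᶻ (i * j)))
      (trans (identityˡ (b ^ᶻ j)) (sym (trans (∙-congˡ (identityˡ ε)) (identityʳ (b ^ᶻ j)))))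
      (λ i → trans (∙-congʳ (^ᶻ-suc a i)) (assoc a (a ^ᶻ i) (b ^ᶻ j)))
      (λ i → begin
        b ^ᶻ j ∙ (a ^ᶻ (1ℤ + i) ∙ z ^ᶻ ((1ℤ + i) * j))         ≈⟨ ∙-congˡ (∙-cong (^ᶻ-suc a i) (z-step i)) ⟩
        b ^ᶻ j ∙ (a ∙ a ^ᶻ i ∙ (z ^ᶻ j ∙ z ^ᶻ (i * j)))       ≈⟨ ∙-congˡ (assoc a (a ^ᶻ i) _) ⟩
        b ^ᶻ j ∙ (a ∙ (a ^ᶻ i ∙ (z ^ᶻ j ∙ z ^ᶻ (i * j))))     ≈⟨ ∙-congˡ (∙-congˡ (swap-left (sym (^ᶻ-^ᶻ-commute za≈az j i)) _)) ⟩
        b ^ᶻ j ∙ (a ∙ (z ^ᶻ j ∙ (a ^ᶻ i ∙ z ^ᶻ (i * j))))     ≈⟨ ∙-congˡ (assoc a (z ^ᶻ j) _) ⟨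
        b ^ᶻ j ∙ (a ∙ z ^ᶻ j ∙ (a ^ᶻ i ∙ z ^ᶻ (i * j)))       ≈⟨ assoc (b ^ᶻ j) (a ∙ z ^ᶻ j) _ ⟨
        b ^ᶻ j ∙ (a ∙ z ^ᶻ j) ∙ (a ^ᶻ i ∙ z ^ᶻ (i * j))       ≈⟨ ∙-congʳ (a-past-bʲ j) ⟨
        a ∙ b ^ᶻ j ∙ (a ^ᶻ i ∙ z ^ᶻ (i * j))                  ≈⟨ assoc a (b ^ᶻ j) _ ⟩
        a ∙ (b ^ᶻ j ∙ (a ^ᶻ i ∙ z ^ᶻ (i * j)))                ∎)
      i
      where
      z-step : ∀ i → z ^ᶻ ((1ℤ + i) * j) ≈ z ^ᶻ j ∙ z ^ᶻ (i * j)
      z-step i = trans (reflexive (≡.cong (z ^ᶻ_) (ℤ.suc-* i j))) (^ᶻ-homo-+ z j (i * j))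

    normalForm : ℤ → ℤ → ℤ → Carrier
    normalForm i j k = b ^ᶻ j ∙ (a ^ᶻ i ∙ z ^ᶻ k)

    -- Moving `A` past `B′` creates `W`; all powers of `z` commute with the rest and are gathered on
    -- the right.
    normalForm-∙ : ∀ i j k i′ j′ k′ → normalForm i j k ∙ normalForm i′ j′ k′ ≈
                   normalForm (i + i′) (j + j′) (k + k′ + i * j′)
    normalForm-∙ i j k i′ j′ k′ = begin
      B ∙ (A ∙ Z) ∙ (B′ ∙ (A′ ∙ Z′))
        ≈⟨ trans (assoc B (A ∙ Z) _) (∙-congˡ (assoc A Z _)) ⟩
      B ∙ (A ∙ (Z ∙ (B′ ∙ (A′ ∙ Z′))))
        ≈⟨ ∙-congˡ (∙-congˡ (swap-left (^ᶻ-^ᶻ-commute zb≈bz k j′) (A′ ∙ Z′))) ⟩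
      B ∙ (A ∙ (B′ ∙ (Z ∙ (A′ ∙ Z′))))
        ≈⟨ ∙-congˡ (∙-congˡ (∙-congˡ (swap-left (^ᶻ-^ᶻ-commute za≈az k i′) Z′))) ⟩
      B ∙ (A ∙ (B′ ∙ (A′ ∙ (Z ∙ Z′))))
        ≈⟨ ∙-congˡ (assoc A B′ _) ⟨
      B ∙ (A ∙ B′ ∙ (A′ ∙ (Z ∙ Z′)))
        ≈⟨ ∙-congˡ (∙-congʳ (aⁱ-past-bʲ i j′)) ⟩
      B ∙ (B′ ∙ (A ∙ W) ∙ (A′ ∙ (Z ∙ Z′)))
        ≈⟨ ∙-congˡ (trans (assoc B′ (A ∙ W) _) (∙-congˡ (assoc A W _))) ⟩
      B ∙ (B′ ∙ (A ∙ (W ∙ (A′ ∙ (Z ∙ Z′)))))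
        ≈⟨ ∙-congˡ (∙-congˡ (∙-congˡ (swap-left (^ᶻ-^ᶻ-commute za≈az (i * j′) i′) (Z ∙ Z′)))) ⟩
      B ∙ (B′ ∙ (A ∙ (A′ ∙ (W ∙ (Z ∙ Z′)))))
        ≈⟨ trans (assoc B B′ _) (∙-congˡ (∙-congˡ (assoc A A′ _))) ⟨
      B ∙ B′ ∙ (A ∙ A′ ∙ (W ∙ (Z ∙ Z′)))
        ≈⟨ ∙-cong (^ᶻ-homo-+ b j j′) (∙-cong (^ᶻ-homo-+ a i i′) z-powers) ⟨
      normalForm (i + i′) (j + j′) (k + k′ + i * j′) ∎
      where
      A  = a ^ᶻ i
      A′ = a ^ᶻ i′
      B  = b ^ᶻ j
      B′ = b ^ᶻ j′
      Z  = z ^ᶻ k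
      Z′ = z ^ᶻ k′
      W  = z ^ᶻ (i * j′)

      z-powers : z ^ᶻ (k + k′ + i * j′) ≈ W ∙ (Z ∙ Z′)
      z-powers = begin
        z ^ᶻ (k + k′ + i * j′)   ≡⟨ ≡.cong (z ^ᶻ_) (ℤ.+-comm (k + k′) (i * j′)) ⟩
        z ^ᶻ (i * j′ + (k + k′)) ≈⟨ ^ᶻ-homo-+ z (i * j′) (k + k′) ⟩
        W ∙ z ^ᶻ (k + k′)        ≈⟨ ∙-congˡ (^ᶻ-homo-+ z k k′) ⟩
        W ∙ (Z ∙ Z′)             ∎

module _ (G : Group c ℓ) where
  open Group G
  open GroupProperties G
  open RawGroupOperations rawGroup

  -- Here `[ x , y ]` equals `(y ∙ x) ⁻¹ ∙ (x ∙ y)`, the right factor that turns `y ∙ x` into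
  -- `x ∙ y`.
  commutator⇒swap : ∀ {x y z} → [ x , y ] ≈ z → x ∙ y ≈ y ∙ (x ∙ z)
  commutator⇒swap {x} {y} {z} [x,y]≈z = sym (trans (sym (assoc y x z))
    (trans (∙-congˡ (trans (sym [x,y]≈z) [x,y]≈yx\\xy)) (\\-leftDividesˡ (y ∙ x) (x ∙ y))))
    where
    [x,y]≈yx\\xy : [ x , y ] ≈ (y ∙ x) ⁻¹ ∙ (x ∙ y)
    [x,y]≈yx\\xy = trans (assoc (x ⁻¹ ∙ y ⁻¹) x y) (∙-congʳ (sym (⁻¹-anti-homo-∙ y x)))

  commutator⇒commute : ∀ {x y} → [ x , y ] ≈ ε → x ∙ y ≈ y ∙ x
  commutator⇒commute {x} {y} e = trans (commutator⇒swap e) (∙-congˡ (identityʳ x))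

-- Coordinates modulo p on the Heisenberg group

-- ⟨ i , j , k ⟩ stands for the group element bʲ aⁱ cᵏ.
record Coordinates : Set where
  constructor ⟨_,_,_⟩
  field α β γ : ℤ
open Coordinates

infixl 7 _⊗_
-- This multiplies upper unitriangular 3 by 3 matrices with `α`, `β` above the diagonal and `γ` in
-- the corner.
_⊗_ : Coordinates → Coordinates → Coordinates
u ⊗ v = ⟨ α u + α v , β u + β v , γ u + γ v + α u * β v ⟩

inverted : Coordinates → Coordinates
inverted w = ⟨ - α w , - β w , α w * β w - γ w ⟩

coordinates : Word Generator → Coordinates
coordinates (gen 𝕒)      = ⟨ 1ℤ , 0ℤ , 0ℤ ⟩
coordinates (gen 𝕓)      = ⟨ 0ℤ , 1ℤ , 0ℤ ⟩
coordinates (gen 𝕔)      = ⟨ 0ℤ , 0ℤ , 1ℤ ⟩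
coordinates Defs.ε       = ⟨ 0ℤ , 0ℤ , 0ℤ ⟩
coordinates (u Defs.∙ v) = coordinates u ⊗ coordinates v
coordinates (u Defs.⁻¹)  = inverted (coordinates u)

module HeisenbergCoordinates (p : ℕ) where
  open BiaffinePlane p
  open Group (𝔾 p) hiding (_-_; refl; sym; trans) renaming (_≈_ to _∼_)
  open GroupProperties (𝔾 p)
  open IntegerPowers (𝔾 p)
  open RawGroupOperations (Group.rawGroup (𝔾 p))
  private module WordPower = RawGroupOperations (wordRawGroup Generator)

  infix 4 _≋_
  record _≋_ (u v : Coordinates) : Set where
    constructor coordinatewise
    field
      α≡ : α u ≡ₚ α v
      β≡ : β u ≡ₚ β v
      γ≡ : γ u ≡ₚ γ v

  ≡⇒≋ : ∀ {u v} → u ≡ v → u ≋ v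
  ≡⇒≋ ≡.refl = coordinatewise ≡ₚ-refl ≡ₚ-refl ≡ₚ-refl

  ≋-sym : ∀ {u v} → u ≋ v → v ≋ u
  ≋-sym (coordinatewise e f g) = coordinatewise (≡ₚ-sym e) (≡ₚ-sym f) (≡ₚ-sym g)

  ≋-trans : ∀ {u v w} → u ≋ v → v ≋ w → u ≋ w
  ≋-trans (coordinatewise e f g) (coordinatewise e′ f′ g′) =
    coordinatewise (≡ₚ-trans e e′) (≡ₚ-trans f f′) (≡ₚ-trans g g′)

  ⊗-cong : ∀ {u u′ v v′} → u ≋ u′ → v ≋ v′ → u ⊗ v ≋ u′ ⊗ v′
  ⊗-cong (coordinatewise e f g) (coordinatewise e′ f′ g′) = coordinatewise
    (+-congₚ e e′) (+-congₚ f f′) (+-congₚ (+-congₚ g g′) (*-congₚ e f′))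

  -- Relators take powers in the raw group of words, cyclic subgroups in the presented group; the
  -- two recursions agree only by induction on `n`.
  word-power : ∀ x n → x WordPower.^ n ≡ x ^ n
  word-power x zero    = ≡.refl
  word-power x (suc n) = ≡.cong (x ∙_) (word-power x n)

  coordinates-aⁿ : ∀ n → coordinates (gen 𝕒 ^ n) ≡ ⟨ + n , 0ℤ , 0ℤ ⟩
  coordinates-aⁿ zero    = ≡.refl
  coordinates-aⁿ (suc n) = ≡.cong (⟨ 1ℤ , 0ℤ , 0ℤ ⟩ ⊗_) (coordinates-aⁿ n)

  coordinates-bⁿ : ∀ n → coordinates (gen 𝕓 ^ n) ≡ ⟨ 0ℤ , + n , 0ℤ ⟩
  coordinates-bⁿ zero    = ≡.refl
  coordinates-bⁿ (suc n) = ≡.cong (⟨ 0ℤ , 1ℤ , 0ℤ ⟩ ⊗_) (coordinates-bⁿ n)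

  coordinates-cⁿ : ∀ n → coordinates (gen 𝕔 ^ n) ≡ ⟨ 0ℤ , 0ℤ , + n ⟩
  coordinates-cⁿ zero    = ≡.refl
  coordinates-cⁿ (suc n) = ≡.trans (≡.cong (⟨ 0ℤ , 0ℤ , 1ℤ ⟩ ⊗_) (coordinates-cⁿ n))
    (≡.cong ⟨ 0ℤ , 0ℤ ,_⟩ (ℤ.+-identityʳ (+ suc n)))

  coordinates-aⁱ : ∀ i → coordinates (gen 𝕒 ^ᶻ i) ≡ ⟨ i , 0ℤ , 0ℤ ⟩
  coordinates-aⁱ (+ n)    = coordinates-aⁿ n
  coordinates-aⁱ -[1+ n ] = ≡.trans (≡.cong inverted (coordinates-aⁿ (suc n)))
    (≡.cong ⟨ -[1+ n ] , 0ℤ ,_⟩ (≡.trans (ℤ.+-identityʳ _) (ℤ.*-zeroʳ (+ suc n))))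

  coordinates-bⁱ : ∀ i → coordinates (gen 𝕓 ^ᶻ i) ≡ ⟨ 0ℤ , i , 0ℤ ⟩
  coordinates-bⁱ (+ n)    = coordinates-bⁿ n
  coordinates-bⁱ -[1+ n ] = ≡.cong inverted (coordinates-bⁿ (suc n))

  coordinates-cⁱ : ∀ i → coordinates (gen 𝕔 ^ᶻ i) ≡ ⟨ 0ℤ , 0ℤ , i ⟩
  coordinates-cⁱ (+ n)    = coordinates-cⁿ n
  coordinates-cⁱ -[1+ n ] = ≡.cong inverted (coordinates-cⁿ (suc n))

  p≡ₚ0 : + p ≡ₚ 0ℤ
  p≡ₚ0 = linear ℤ∣.∣-refl (ℤ.+-identityʳ (+ p))

  ⊗-assoc : ∀ u v w → (u ⊗ v) ⊗ w ≋ u ⊗ (v ⊗ w)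
  ⊗-assoc ⟨ x , y , z ⟩ ⟨ x′ , y′ , z′ ⟩ ⟨ x″ , y″ , z″ ⟩ = coordinatewise
    (≡⇒≡ₚ (ℤ.+-assoc x x′ x″)) (≡⇒≡ₚ (ℤ.+-assoc y y′ y″))
    (≡⇒≡ₚ (eq x x′ y′ y″ z z′ z″))
    where
    eq : ∀ x x′ y′ y″ z z′ z″ →
         z + z′ + x * y′ + z″ + (x + x′) * y″ ≡ z + (z′ + z″ + x′ * y″) + x * (y′ + y″)
    eq = solve-∀

  ⊗-identityˡ : ∀ u → ⟨ 0ℤ , 0ℤ , 0ℤ ⟩ ⊗ u ≋ u
  ⊗-identityˡ ⟨ x , y , z ⟩ = coordinatewise
    (≡⇒≡ₚ (ℤ.+-identityˡ x)) (≡⇒≡ₚ (ℤ.+-identityˡ y)) (≡⇒≡ₚ (eq y z))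
    where
    eq : ∀ y z → 0ℤ + z + 0ℤ * y ≡ z
    eq = solve-∀

  ⊗-identityʳ : ∀ u → u ⊗ ⟨ 0ℤ , 0ℤ , 0ℤ ⟩ ≋ u
  ⊗-identityʳ ⟨ x , y , z ⟩ = coordinatewise
    (≡⇒≡ₚ (ℤ.+-identityʳ x)) (≡⇒≡ₚ (ℤ.+-identityʳ y)) (≡⇒≡ₚ (eq x z))
    where
    eq : ∀ x z → z + 0ℤ + x * 0ℤ ≡ z
    eq = solve-∀

  ⊗-inverseˡ : ∀ u → inverted u ⊗ u ≋ ⟨ 0ℤ , 0ℤ , 0ℤ ⟩
  ⊗-inverseˡ ⟨ x , y , z ⟩ = coordinatewise
    (≡⇒≡ₚ (ℤ.+-inverseˡ x)) (≡⇒≡ₚ (ℤ.+-inverseˡ y)) (≡⇒≡ₚ (eq x y z))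
    where
    eq : ∀ x y z → x * y - z + z + (- x) * y ≡ 0ℤ
    eq = solve-∀

  ⊗-inverseʳ : ∀ u → u ⊗ inverted u ≋ ⟨ 0ℤ , 0ℤ , 0ℤ ⟩
  ⊗-inverseʳ ⟨ x , y , z ⟩ = coordinatewise
    (≡⇒≡ₚ (ℤ.+-inverseʳ x)) (≡⇒≡ₚ (ℤ.+-inverseʳ y)) (≡⇒≡ₚ (eq x y z))
    where
    eq : ∀ x y z → z + (x * y - z) + x * (- y) ≡ 0ℤ
    eq = solve-∀

  -- Both the relators and the group laws hold for matrices modulo `p`. This is how elements of
  -- `𝔾 p` are told apart.
  coordinates-cong : ∀ {u v} → u ∼ v → coordinates u ≋ coordinates v
  coordinates-cong (relation aᵖ=1) = ≋-trans
    (≡⇒≋ (≡.trans (≡.cong coordinates (word-power (gen 𝕒) p)) (coordinates-aⁿ p)))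
    (coordinatewise p≡ₚ0 ≡ₚ-refl ≡ₚ-refl)
  coordinates-cong (relation bᵖ=1) = ≋-trans
    (≡⇒≋ (≡.trans (≡.cong coordinates (word-power (gen 𝕓) p)) (coordinates-bⁿ p)))
    (coordinatewise ≡ₚ-refl p≡ₚ0 ≡ₚ-refl)
  coordinates-cong (relation cᵖ=1) = ≋-trans
    (≡⇒≋ (≡.trans (≡.cong coordinates (word-power (gen 𝕔) p)) (coordinates-cⁿ p)))
    (coordinatewise ≡ₚ-refl ≡ₚ-refl p≡ₚ0)
  coordinates-cong (relation [a,b]=c) = ≡⇒≋ ≡.refl
  coordinates-cong (relation [c,a]=1) = ≡⇒≋ ≡.refl
  coordinates-cong (relation [c,b]=1) = ≡⇒≋ ≡.refl
  coordinates-cong ∼-refl        = ≡⇒≋ ≡.refl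
  coordinates-cong (∼-sym e)     = ≋-sym (coordinates-cong e)
  coordinates-cong (∼-trans e f) = ≋-trans (coordinates-cong e) (coordinates-cong f)
  coordinates-cong (Defs.∙-cong e f)  = ⊗-cong (coordinates-cong e) (coordinates-cong f)
  coordinates-cong (Defs.⁻¹-cong e) with coordinates-cong e
  ... | coordinatewise α≡ β≡ γ≡ = coordinatewise (neg-congₚ α≡) (neg-congₚ β≡)
    (+-congₚ (*-congₚ α≡ β≡) (neg-congₚ γ≡))
  coordinates-cong (Defs.assoc u v w) = ⊗-assoc (coordinates u) (coordinates v) (coordinates w)
  coordinates-cong (Defs.identityˡ u) = ⊗-identityˡ (coordinates u)
  coordinates-cong (Defs.identityʳ u) = ⊗-identityʳ (coordinates u)
  coordinates-cong (Defs.inverseˡ u)  = ⊗-inverseˡ (coordinates u)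
  coordinates-cong (Defs.inverseʳ u)  = ⊗-inverseʳ (coordinates u)

  ab∼bac : gen 𝕒 ∙ gen 𝕓 ∼ gen 𝕓 ∙ (gen 𝕒 ∙ gen 𝕔)
  ab∼bac = commutator⇒swap (𝔾 p) (relation [a,b]=c)

  open Collection ab∼bac (commutator⇒commute (𝔾 p) (relation [c,a]=1))
                         (commutator⇒commute (𝔾 p) (relation [c,b]=1))

  coordinates-normalForm : ∀ i j k → coordinates (normalForm i j k) ≋ ⟨ i , j , k ⟩
  coordinates-normalForm i j k = ≋-trans
    (⊗-cong (≡⇒≋ (coordinates-bⁱ j)) (⊗-cong (≡⇒≋ (coordinates-aⁱ i)) (≡⇒≋ (coordinates-cⁱ k))))
    (coordinatewise (≡⇒≡ₚ (α-eq i)) (≡⇒≡ₚ (ℤ.+-identityʳ j)) (≡⇒≡ₚ (γ-eq i k)))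
    where
    α-eq : ∀ i → 0ℤ + (i + 0ℤ) ≡ i
    α-eq = solve-∀

    γ-eq : ∀ i k → 0ℤ + (0ℤ + k + i * 0ℤ) + 0ℤ ≡ k
    γ-eq = solve-∀

  word : Coordinates → Word Generator
  word ⟨ i , j , k ⟩ = normalForm i j k

  power-relation : ∀ x → x WordPower.^ p ∼ ε → x ^ p ∼ ε
  power-relation x = ≡.subst (_∼ ε) (word-power x p)

  word-cong : ∀ {u v} → u ≋ v → word u ∼ word v
  word-cong (coordinatewise α≡ β≡ γ≡) = ∙-cong
    (^ᶻ-cong-mod (power-relation (gen 𝕓) (relation bᵖ=1)) β≡)
    (∙-cong (^ᶻ-cong-mod (power-relation (gen 𝕒) (relation aᵖ=1)) α≡)
            (^ᶻ-cong-mod (power-relation (gen 𝕔) (relation cᵖ=1)) γ≡))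

  word-⊗ : ∀ u v → word u ∙ word v ∼ word (u ⊗ v)
  word-⊗ u v = normalForm-∙ (α u) (β u) (γ u) (α v) (β v) (γ v)

  word-ε : word ⟨ 0ℤ , 0ℤ , 0ℤ ⟩ ∼ ε
  word-ε = ∼-trans (identityˡ (ε ∙ ε)) (identityˡ ε)

  -- Induction on the word: products are collected by `word-⊗`, and inverses are recognised by their
  -- uniqueness.
  word-coordinates : ∀ w → w ∼ word (coordinates w)
  word-coordinates (gen 𝕒) = ∼-sym (∼-trans (identityˡ _) (∼-trans (identityʳ _) (identityʳ _)))
  word-coordinates (gen 𝕓) = ∼-sym (∼-trans (∙-cong (identityʳ _) (identityˡ ε)) (identityʳ _))
  word-coordinates (gen 𝕔) = ∼-sym (∼-trans (identityˡ _) (∼-trans (identityˡ _) (identityʳ _)))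
  word-coordinates Defs.ε  = ∼-sym word-ε
  word-coordinates (u Defs.∙ v) =
    ∼-trans (∙-cong (word-coordinates u) (word-coordinates v)) (word-⊗ (coordinates u) (coordinates v))
  word-coordinates (u Defs.⁻¹) = ∼-sym (∼-trans
    (inverseˡ-unique (word (inverted w)) (word w)
      (∼-trans (word-⊗ (inverted w) w) (∼-trans (word-cong (⊗-inverseˡ w)) word-ε)))
    (⁻¹-cong (∼-sym (word-coordinates u))))
    where w = coordinates u

  coordinates-injective : ∀ {u v} → coordinates u ≋ coordinates v → u ∼ v
  coordinates-injective {u} {v} e =
    ∼-trans (word-coordinates u) (∼-trans (word-cong e) (∼-sym (word-coordinates v)))

  -- Cosets as points and lines

  -- Left multiplication by `aⁱ` changes `α` to `α + i` and `γ` to `γ + i β`, so `β` and `γ - α β`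
  -- are invariants; left multiplication by `bⁱ` changes only `β`.
  pointOf lineOf : Coordinates → Vertex
  pointOf w = point (β w) (γ w - α w * β w)
  lineOf  w = line (α w) (γ w)

  pointOf-cong : ∀ {u v} → u ≋ v → pointOf u ≈ pointOf v
  pointOf-cong (coordinatewise α≡ β≡ γ≡) =
    point β≡ (+-congₚ γ≡ (neg-congₚ (*-congₚ α≡ β≡)))

  lineOf-cong : ∀ {u v} → u ≋ v → lineOf u ≈ lineOf v
  lineOf-cong (coordinatewise α≡ β≡ γ≡) = line α≡ γ≡

  pointOf-aⁱ⊗ : ∀ i w → pointOf (⟨ i , 0ℤ , 0ℤ ⟩ ⊗ w) ≈ pointOf w
  pointOf-aⁱ⊗ i ⟨ x , y , z ⟩ = 
    point (≡⇒≡ₚ (ℤ.+-identityˡ y)) (≡⇒≡ₚ (eq i x y z))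
    where
    eq : ∀ i x y z → 0ℤ + z + i * y - (i + x) * (0ℤ + y) ≡ z - x * y
    eq = solve-∀

  lineOf-bⁱ⊗ : ∀ i w → lineOf (⟨ 0ℤ , i , 0ℤ ⟩ ⊗ w) ≈ lineOf w
  lineOf-bⁱ⊗ i ⟨ x , y , z ⟩ = 
    line (≡⇒≡ₚ (ℤ.+-identityˡ x)) (≡⇒≡ₚ (eq y z))
    where
    eq : ∀ y z → 0ℤ + z + 0ℤ * y ≡ z
    eq = solve-∀

  -- The invariants are complete: the exponent of `a` is read off from the `α` coordinates, and the
  -- invariants then force `γ`.
  pointOf-≈ : ∀ u v → pointOf u ≈ pointOf v → u ≋ ⟨ α u - α v , 0ℤ , 0ℤ ⟩ ⊗ v
  pointOf-≈ ⟨ x , y , z ⟩ ⟨ x′ , y′ , z′ ⟩ (point y≡y′ e) = coordinatewise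
    (≡⇒≡ₚ (i≡i-j+j x x′)) (≡ₚ-trans y≡y′ (≡⇒≡ₚ (≡.sym (ℤ.+-identityˡ y′))))
    (linear (1ℤ ⟨*⟩ e ⊞ x ⟨*⟩ y≡y′) (eq x x′ y y′ z z′))
    where
    eq : ∀ x x′ y y′ z z′ → z - (0ℤ + z′ + (x - x′) * y′) ≡
         1ℤ * (z - x * y - (z′ - x′ * y′)) + x * (y - y′)
    eq = solve-∀

  lineOf-≈ : ∀ u v → lineOf u ≈ lineOf v → u ≋ ⟨ 0ℤ , β u - β v , 0ℤ ⟩ ⊗ v
  lineOf-≈ ⟨ x , y , z ⟩ ⟨ x′ , y′ , z′ ⟩ (line x≡x′ z≡z′) = coordinatewise
    (≡ₚ-trans x≡x′ (≡⇒≡ₚ (≡.sym (ℤ.+-identityˡ x′)))) (≡⇒≡ₚ (i≡i-j+j y y′))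
    (≡ₚ-trans z≡z′ (≡⇒≡ₚ (eq y′ z′)))
    where
    eq : ∀ y z → z ≡ 0ℤ + z + 0ℤ * y
    eq = solve-∀

  ∈⟨a⟩g⇒ : ∀ {g z} → rightCoset (𝔾 p) (⟨a⟩ p) g z → pointOf (coordinates z) ≈ pointOf (coordinates g)
  ∈⟨a⟩g⇒ {g} (h , (i , h∼aⁱ) , z∼hg) = ≈-trans
    (pointOf-cong (≋-trans (coordinates-cong (∼-trans z∼hg (∙-congʳ h∼aⁱ)))
                           (⊗-cong (≡⇒≋ (coordinates-aⁱ i)) (≡⇒≋ ≡.refl))))
    (pointOf-aⁱ⊗ i (coordinates g))

  ∈⟨b⟩g⇒ : ∀ {g z} → rightCoset (𝔾 p) (⟨b⟩ p) g z → lineOf (coordinates z) ≈ lineOf (coordinates g)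
  ∈⟨b⟩g⇒ {g} (h , (i , h∼bⁱ) , z∼hg) = ≈-trans
    (lineOf-cong (≋-trans (coordinates-cong (∼-trans z∼hg (∙-congʳ h∼bⁱ)))
                          (⊗-cong (≡⇒≋ (coordinates-bⁱ i)) (≡⇒≋ ≡.refl))))
    (lineOf-bⁱ⊗ i (coordinates g))

  ⇒∈⟨a⟩g : ∀ {g z} → pointOf (coordinates z) ≈ pointOf (coordinates g) → rightCoset (𝔾 p) (⟨a⟩ p) g z
  ⇒∈⟨a⟩g {g} {z} e = gen 𝕒 ^ᶻ i , (i , ∼-refl) , coordinates-injective
    (≋-trans (pointOf-≈ (coordinates z) (coordinates g) e)
      (⊗-cong (≋-sym (≡⇒≋ (coordinates-aⁱ i))) (≡⇒≋ ≡.refl)))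
    where i = α (coordinates z) - α (coordinates g)

  ⇒∈⟨b⟩g : ∀ {g z} → lineOf (coordinates z) ≈ lineOf (coordinates g) → rightCoset (𝔾 p) (⟨b⟩ p) g z
  ⇒∈⟨b⟩g {g} {z} e = gen 𝕓 ^ᶻ i , (i , ∼-refl) , coordinates-injective
    (≋-trans (lineOf-≈ (coordinates z) (coordinates g) e)
      (⊗-cong (≋-sym (≡⇒≋ (coordinates-bⁱ i))) (≡⇒≋ ≡.refl)))
    where i = β (coordinates z) - β (coordinates g)

-- The isomorphism from the coset graph to the biaffine plane

module _ {p : ℕ} (p-prime : Prime p) where
  open BiaffinePlane p
  open HeisenbergCoordinates p
  private module Σ = Graph (heisenbergGraph p-prime)

  cosetVertex : CosetRep (Word Generator) → Vertex
  cosetVertex (H-coset g) = pointOf (coordinates g)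
  cosetVertex (K-coset g) = lineOf (coordinates g)

  cosetVertex-cong : ∀ {u v} → u Σ.≈ᵥ v → cosetVertex u ≈ cosetVertex v
  -- Since `g` lies in its own coset, it lies in that of `h` and has the invariants of `h`.
  cosetVertex-cong {H-coset g} {H-coset h} (⊆ , _) = ∈⟨a⟩g⇒ (⊆ (⇒∈⟨a⟩g {g} {g} ≈-refl))
  cosetVertex-cong {K-coset g} {K-coset h} (⊆ , _) = ∈⟨b⟩g⇒ (⊆ (⇒∈⟨b⟩g {g} {g} ≈-refl))
  cosetVertex-cong {H-coset g} {K-coset h} e       = ⊥-elim (⟨a⟩g≠⟨b⟩h p-prime g h e)
  cosetVertex-cong {K-coset g} {H-coset h} e       = ⊥-elim (⟨a⟩g≠⟨b⟩h p-prime h g (≐-sym e))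

  cosetVertex-injective : ∀ {u v} → cosetVertex u ≈ cosetVertex v → u Σ.≈ᵥ v
  cosetVertex-injective {H-coset g} {H-coset h} e =
    (λ z∈ → ⇒∈⟨a⟩g (≈-trans (∈⟨a⟩g⇒ z∈) e)) , (λ z∈ → ⇒∈⟨a⟩g (≈-trans (∈⟨a⟩g⇒ z∈) (≈-sym e)))
  cosetVertex-injective {K-coset g} {K-coset h} e =
    (λ z∈ → ⇒∈⟨b⟩g (≈-trans (∈⟨b⟩g⇒ z∈) e)) , (λ z∈ → ⇒∈⟨b⟩g (≈-trans (∈⟨b⟩g⇒ z∈) (≈-sym e)))

  coset : Vertex → CosetRep (Word Generator)
  coset (point x y) = H-coset (word ⟨ 0ℤ , x , y ⟩)
  coset (line m k)  = K-coset (word ⟨ m , 0ℤ , k ⟩)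

  cosetVertex-coset : ∀ v → cosetVertex (coset v) ≈ v
  cosetVertex-coset (point x y) = ≈-trans (pointOf-cong (coordinates-normalForm 0ℤ x y))
    (point ≡ₚ-refl (≡⇒≡ₚ (ℤ.+-identityʳ y)))
  cosetVertex-coset (line m k)  = lineOf-cong (coordinates-normalForm m 0ℤ k)

  -- Incidence reads `γ = (γ - α β) + α β`; hence two cosets that share an element give incident
  -- vertices.
  pointOf~lineOf : ∀ w → pointOf w ~ lineOf w
  pointOf~lineOf ⟨ x , y , z ⟩ = point~line (≡⇒≡ₚ (i≡i-j+j z (x * y)))

  meeting⇒~ : ∀ {u v} → MeetingPair (𝔾 p) (⟨a⟩ p) (⟨b⟩ p) u v → cosetVertex u ~ cosetVertex v
  meeting⇒~ {u} {v} (g , h , u≈⟨a⟩g , v≈⟨b⟩h , z , z∈⟨a⟩g , z∈⟨b⟩h) = ~-resp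
    (≈-trans (∈⟨a⟩g⇒ z∈⟨a⟩g) (≈-sym (cosetVertex-cong {u} {H-coset g} u≈⟨a⟩g)))
    (≈-trans (∈⟨b⟩g⇒ z∈⟨b⟩h) (≈-sym (cosetVertex-cong {v} {K-coset h} v≈⟨b⟩h)))
    (pointOf~lineOf (coordinates z))

  ~⇒meeting : ∀ {g h} → pointOf (coordinates g) ~ lineOf (coordinates h) →
              MeetingPair (𝔾 p) (⟨a⟩ p) (⟨b⟩ p) (H-coset g) (K-coset h)
  ~⇒meeting {g} {h} g~h = g , h , ≐-refl , ≐-refl , z
    , ⇒∈⟨a⟩g (≈-trans (pointOf-cong z-coordinates) (onPoint (coordinates g) (coordinates h) g~h))
    , ⇒∈⟨b⟩g (lineOf-cong {v = ⟨ α (coordinates h) , β (coordinates g) , γ (coordinates h) ⟩} z-coordinates)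
    where
    -- A common element must take `α` and `γ` from the line and `β` from the point; incidence then
    -- gives it the ordinate of the point.
    z = word ⟨ α (coordinates h) , β (coordinates g) , γ (coordinates h) ⟩

    z-coordinates : coordinates z ≋ ⟨ α (coordinates h) , β (coordinates g) , γ (coordinates h) ⟩
    z-coordinates = coordinates-normalForm _ _ _

    onPoint : ∀ u v → pointOf u ~ lineOf v → pointOf ⟨ α v , β u , γ v ⟩ ≈ pointOf u
    onPoint ⟨ x , y , z ⟩ ⟨ x′ , y′ , z′ ⟩ (point~line e) =
      point ≡ₚ-refl (linear (1ℤ ⟨*⟩ e) (eq x y z x′ z′))
      where
      eq : ∀ x y z x′ z′ → z′ - x′ * y - (z - x * y) ≡ 1ℤ * (z′ - (z - x * y + x′ * y))
      eq = solve-∀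

  ~⇒adjacent : ∀ u v → cosetVertex u ~ cosetVertex v → Σ.Adj u v
  ~⇒adjacent (H-coset g) (K-coset h) u~v = inj₁ (~⇒meeting u~v)
  ~⇒adjacent (K-coset g) (H-coset h) u~v = inj₂ (~⇒meeting (~-sym u~v))

  adjacent⇒~ : ∀ {u v} → Σ.Adj u v → cosetVertex u ~ cosetVertex v
  adjacent⇒~ {u} {v} (inj₁ m) = meeting⇒~ {u} {v} m
  adjacent⇒~ {u} {v} (inj₂ m) = ~-sym (meeting⇒~ {v} {u} m)

  heisenbergGraph≅plane : heisenbergGraph p-prime ≅ plane
  heisenbergGraph≅plane = record
    { bijection = record
      { to        = cosetVertex
      ; from      = coset
      ; to-cong   = λ {u} {v} → cosetVertex-cong {u} {v}
      ; from-cong = λ {u} {v} → coset-cong {u} {v}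
      ; inverse   = strictlyInverseˡ⇒inverseˡ Σ.vertices (Graph.vertices plane)
                      {f = cosetVertex} {f⁻¹ = coset}
                      (λ {u} {v} → cosetVertex-cong {u} {v}) cosetVertex-coset
                  , strictlyInverseʳ⇒inverseʳ Σ.vertices (Graph.vertices plane)
                      {f⁻¹ = coset} {f = cosetVertex}
                      (λ {u} {v} → coset-cong {u} {v})
                      (λ v → cosetVertex-injective {coset (cosetVertex v)} {v}
                               (cosetVertex-coset (cosetVertex v)))
      }
    ; adjacency = λ u v → mk⇔ (adjacent⇒~ {u} {v}) (~⇒adjacent u v)
    }
    where
    coset-cong : ∀ {u v} → u ≈ v → coset u Σ.≈ᵥ coset v
    coset-cong {u} {v} u≈v = cosetVertex-injective {coset u} {coset v}
      (≈-trans (cosetVertex-coset u) (≈-trans u≈v (≈-sym (cosetVertex-coset v))))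

mainTheorem3 : (p : ℕ) (p-prime : Prime p) → 2 ∤ p → 3-ArcRegular (heisenbergGraph p-prime)
mainTheorem3 p p-prime _ =
  3-ArcRegular-resp-≅ (heisenbergGraph≅plane p-prime) (plane-3-arc-regular p-prime)
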